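{- Let $\Theta:S_n(321)\to S_n(132)$ be the Elizalde–Pak bijection described in the context. For $\sigma\in S_n(321)$ with $n>1$, let $\pi=\mathrm{red}(\sigma(1)\cdots\sigma(n-1))\in S_{n-1}(321)$ and let $j-1$ be the number of matched excedance values of $\pi$ (output by the matching algorithm applied to $\pi$) that are less than $\sigma(n)$. Then $\Theta(\sigma)=\Theta(\pi)^{(n-\sigma(n)+j,\,j)}$, while $\Theta(\sigma)=\sigma$ if $|\sigma|=1$. Conversely, for $\alpha\in S_m(132)$: if $m=1$ then $\Theta^{ -1}(\alpha)=\alpha$, and if $m>1$ then $\Theta^{ -1}(\alpha)=\Theta^{ -1}(\beta)^{(m,\,m+\alpha(k)-k)}$, where $k$ is the smallest index with $\alpha(k)\le k$ and $\beta\in S_{m-1}(132)$ is the permutation with $\beta^{(k,\alpha(k))}=\alpha$.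
   Context: $S_n(\tau)$ is the set of permutations of $[n]$ avoiding pattern $\tau$; $\mathrm{red}$ of a sequence of distinct integers is the permutation of $[k]$ with the same relative order. For $\sigma\in S_n$: $\sigma^{b\rtimes 1}$ is obtained by adding $1$ to every entry $\ge b$; for $1\le a,b\le n+1$, $\sigma^{(a,b)}=\sigma^{b\rtimes1}(1)\cdots\sigma^{b\rtimes1}(a-1)\,b\,\sigma^{b\rtimes1}(a)\cdots\sigma^{b\rtimes1}(n)\in S_{n+1}$ (insert value $b$ at position $a$). Index $i$ is an excedance of $\sigma$ if $\sigma(i)>i$ and a non-excedance otherwise. Matching algorithm: given $\sigma\in S_n$ with excedances $e_1<\dots<e_k$ and non-excedances $a_1<\dots<a_{n-k}$, set $p=q=1$, $\mathcal M=\emptyset$; while $p\le k$ and $q\le n-k$: if $e_p>a_q$ then $q:=q+1$; else if $\sigma(e_p)<\sigma(a_q)$ then $p:=p+1$; else add $(\sigma(e_p),a_q)$ to $\mathcal M$ and set $p:=p+1,q:=q+1$. The matched excedance values are the first coordinates of the pairs in $\mathcal M$. Definition of $\Theta$: For $\sigma\in S_n(321)$ let $(P,Q)$ be the insertion and recording tableaux of the Robinson–Schensted (RSK) row-insertion correspondence applied to $\sigma$; they have at most two rows. Let $\Psi(\sigma)$ be the path of $2n$ steps $u=(1,1)$, $d=(1,-1)$ whose first $n$ steps are, for $i=1,\dots,n$, $u$ if $i$ lies in the first row of $P$ and $d$ if in the second row, and whose last $n$ steps are, for $j=n,n-1,\dots,1$, $u$ if $j$ lies in the second row of $Q$ and $d$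 if in the first row; this is a Dyck path of semilength $n$ (never below the $x$-axis, ending at $(2n,0)$). In a Dyck path each up-step is matched (by a tunnel) with the first later down-step ending at the height where the up-step starts. Label the up-steps from left to right $n,n-1,\dots,1$ and the down-steps from left to right $1,2,\dots,n$; $\Phi^{ -1}(D)$ is the permutation $\tau$ with $\tau(\ell)=m$ whenever the up-step labelled $\ell$ is matched with the down-step labelled $m$. $\Phi^{ -1}$ is a bijection from Dyck paths of semilength $n$ to $S_n(132)$, and $\Theta=\Phi^{ -1}\circ\Psi$. -}

module Defs where

open import Data.Nat using (ℕ; zero; suc; _+_; _∸_; _≤_; _<_; _<ᵇ_; _≤ᵇ_; _≡ᵇ_)
open import Data.Bool using (Bool; true; false; if_then_else_)
open import Data.List using (List; []; _∷_; _++_; map; take; drop; length; filter; applyUpTo; reverse; foldl)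
open import Data.Bool.ListAction using (any)
open import Data.Maybe using (Maybe; just; nothing)
open import Data.Product using (_×_; _,_; proj₁; proj₂)
open import Data.List.Relation.Binary.Permutation.Propositional using (_↭_)
open import Relation.Nullary using (¬_)
open import Relation.Binary.PropositionalEquality using (_≡_)

-- Permutations are represented in one-line notation as lists of ℕ.

[1…_] : ℕ → List ℕ
[1… n ] = applyUpTo suc n

IsPerm : ℕ → List ℕ → Set
IsPerm n σ = σ ↭ [1… n ]

-- 1-based evaluation σ(i) (returns 0 outside 1..|σ|)
_⟨_⟩ : List ℕ → ℕ → ℕ
[]       ⟨ _ ⟩           = 0
(x ∷ xs) ⟨ zero ⟩        = 0
(x ∷ xs) ⟨ suc zero ⟩    = x
(x ∷ xs) ⟨ suc (suc i) ⟩ = xs ⟨ suc i ⟩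

lastOf : List ℕ → ℕ
lastOf σ = σ ⟨ length σ ⟩

Avoids321 : List ℕ → Set
Avoids321 σ = ∀ i j k → 1 ≤ i → i < j → j < k → k ≤ length σ →
  ¬ (σ ⟨ k ⟩ < σ ⟨ j ⟩ × σ ⟨ j ⟩ < σ ⟨ i ⟩)

Avoids132 : List ℕ → Set
Avoids132 σ = ∀ i j k → 1 ≤ i → i < j → j < k → k ≤ length σ →
  ¬ (σ ⟨ i ⟩ < σ ⟨ k ⟩ × σ ⟨ k ⟩ < σ ⟨ j ⟩)

red : List ℕ → List ℕ
red xs = map (λ x → suc (length (filter (λ y → y Data.Nat.<? x) xs))) xs

shiftFrom : ℕ → List ℕ → List ℕ
shiftFrom b = map (λ x → if b ≤ᵇ x then suc x else x)

ins : List ℕ → ℕ → ℕ → List ℕ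
ins σ a b = take (a ∸ 1) (shiftFrom b σ) ++ (b ∷ drop (a ∸ 1) (shiftFrom b σ))

excedances : List ℕ → List ℕ
excedances σ = filter (λ i → i Data.Nat.<? σ ⟨ i ⟩) [1… length σ ]

nonExcedances : List ℕ → List ℕ
nonExcedances σ = filter (λ i → σ ⟨ i ⟩ Data.Nat.≤? i) [1… length σ ]

matchLoop : List ℕ → List ℕ → List ℕ → List (ℕ × ℕ)
matchLoop σ [] _ = []
matchLoop σ (e ∷ es) [] = []
matchLoop σ (e ∷ es) (a ∷ as) =
  if a <ᵇ e then matchLoop σ (e ∷ es) as
  else (if σ ⟨ e ⟩ <ᵇ σ ⟨ a ⟩ then matchLoop σ es (a ∷ as)
        else ((σ ⟨ e ⟩ , a) ∷ matchLoop σ es as))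

matching : List ℕ → List (ℕ × ℕ)
matching σ = matchLoop σ (excedances σ) (nonExcedances σ)

matchedExcValues : List ℕ → List ℕ
matchedExcValues σ = map proj₁ (matching σ)

Tableau : Set
Tableau = List (List ℕ)

rowIns : ℕ → List ℕ → Maybe ℕ × List ℕ
rowIns x [] = nothing , (x ∷ [])
rowIns x (y ∷ ys) with x <ᵇ y
... | true  = just y , (x ∷ ys)
... | false with rowIns x ys
...   | b , ys' = b , (y ∷ ys')

-- insert into a tableau; returns new tableau and (0-based) row of new box
tabIns : ℕ → Tableau → Tableau × ℕ
tabIns x [] = ((x ∷ []) ∷ []) , 0
tabIns x (r ∷ rs) with rowIns x r
... | nothing , r' = (r' ∷ rs) , 0
... | just y , r' with tabIns y rs
...   | rs' , k = (r' ∷ rs') , suc k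

addAt : ℕ → ℕ → Tableau → Tableau
addAt zero i [] = (i ∷ []) ∷ []
addAt zero i (r ∷ rs) = (r ++ (i ∷ [])) ∷ rs
addAt (suc k) i [] = (i ∷ []) ∷ []
addAt (suc k) i (r ∷ rs) = r ∷ addAt k i rs

rsStep : Tableau × Tableau × ℕ → ℕ → Tableau × Tableau × ℕ
rsStep (P , Q , i) x with tabIns x P
... | P' , k = P' , addAt k (suc i) Q , suc i

RS : List ℕ → Tableau × Tableau
RS σ with foldl rsStep ([] , [] , 0) σ
... | P , Q , _ = P , Q

rowOf : ℕ → Tableau → List ℕ
rowOf _ [] = []
rowOf zero (r ∷ rs) = r
rowOf (suc k) (r ∷ rs) = rowOf k rs

elemᵇ : ℕ → List ℕ → Bool
elemᵇ i r = any (λ y → y ≡ᵇ i) r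

-- Ψ : lattice path (true = u, false = d)

Ψ : List ℕ → List Bool
Ψ σ = map (λ i → elemᵇ i (rowOf 0 P)) [1… n ]
   ++ map (λ j → elemᵇ j (rowOf 1 Q)) (reverse [1… n ])
  where
  n = length σ
  P = proj₁ (RS σ)
  Q = proj₂ (RS σ)

-- Φ⁻¹ : Dyck path ↦ permutation via tunnels.
-- up-steps labelled n, n-1, ..., 1 left to right; down-steps 1, ..., n;
-- each down-step is matched with the most recent unmatched up-step
-- (equivalently: each up-step with the first later down-step returning
-- to its starting height).

tunnels : ℕ → List Bool → ℕ → ℕ → List ℕ → List (ℕ × ℕ)
tunnels n [] u d st = []
tunnels n (true ∷ ps) u d st = tunnels n ps (suc u) d ((n ∸ u) ∷ st)
tunnels n (false ∷ ps) u d [] = tunnels n ps u (suc d) []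
tunnels n (false ∷ ps) u d (ℓ ∷ st) = (ℓ , suc d) ∷ tunnels n ps u (suc d) st

assoc : ℕ → List (ℕ × ℕ) → ℕ
assoc ℓ [] = 0
assoc ℓ ((a , b) ∷ ps) = if a ≡ᵇ ℓ then b else assoc ℓ ps

Φinv : ℕ → List Bool → List ℕ
Φinv n D = map (λ ℓ → assoc ℓ T) [1… n ]
  where T = tunnels n D 0 0 []

Θ : List ℕ → List ℕ
Θ σ = Φinv (length σ) (Ψ σ)

{-# OPTIONS --safe #-}
-- Write σ as π with a last entry v appended. The second row of P(π) consists of the excedance values
-- matched by the algorithm. As σ avoids 321, the letters of the left half of Ψ(π) from position v on
-- are d…du…u, and appending v to the insertion turns Ψ(π) into the same path with a peak ud inserted
-- after its first v − 1 steps. Under tunnels this peak contributes the entry of value j = (number of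
-- preceding d's) + 1 at position n − (number of preceding u's), and renumbers the rest as in an insertion.
-- Conversely α is obtained from Φ⁻¹(Ψ(τ)) by some insertion; avoidance of 132 and the minimality of k
-- force the prefix of Ψ(τ) of length m − k + α(k) − 1 to contain exactly α(k) − 1 down-steps and to be
-- followed by no peak in the left half, so the insertion is again that of a peak.
module Submission where

-- Passing from `π` to `σ` lengthens each half of the path by one letter, although both letters of
-- the peak enter at one place. What happens is that the left half grows by two letters and hands
-- its last one across the middle. So the comparison is between the left half of `Ψ π` and the left
-- half of `Ψ σ` together with the first letter of its right half. That extra letter records whether
-- the last insertion bumps, that is, whether the first row had an entry at least `v`; the form
-- d...du...u lets the last letter of the old left half answer this. In the converse the constant is
-- forced. To create the value `a + 1` at position `κ + 1` in a permutation of size `N + 1`, a peak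
-- must be preceded by `a` down-steps and `N - κ` up-steps, so by a prefix of length `N - κ + a`,
-- which is one less than `m + α(k) - k`. The real content is that the prefix of this length has
-- this composition. The converse is then settled by evaluating `Θ` on the proposed permutation with
-- the same insertion formula as in the forward direction.

open import Defs
open import Data.Nat using (ℕ; zero; suc; pred; _+_; _∸_; _≤_; _<_; _<ᵇ_; _≤ᵇ_; _≡ᵇ_; z≤n; s≤s; >-nonZero; _<?_;
  _≤?_; _≟_)
open import Data.Nat.Properties
open import Data.Bool using (Bool; true; false; if_then_else_)
open import Data.Empty using (⊥; ⊥-elim)
open import Data.Fin using (Fin; toℕ; fromℕ<)
open import Data.Fin.Properties using (injective⇒≤; toℕ<n; toℕ-injective; toℕ-fromℕ<)
open import Data.List using (List; []; _∷_; [_]; _++_; _∷ʳ_; map; take; drop; length; filter; applyUpTo; reverse;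
  foldl)
open import Data.List.Properties using (foldl-∷ʳ; length-map; length-++; length-take; length-applyUpTo;
  map-applyUpTo; applyUpTo-∷ʳ; take-all; drop-all; take++drop≡id; ++-assoc; ++-identityʳ; map-∘; map-id-local;
  map-cong-local; filter-accept; filter-reject; filter-none; reverse-++)
open import Data.List.Membership.Propositional using (_∈_; _∉_)
open import Data.List.Membership.Propositional.Properties using (∈-++⁺ˡ; ∈-++⁺ʳ; ∈-++⁻; ∈-map⁺; ∈-map⁻;
  ∈-applyUpTo⁺; ∈-applyUpTo⁻; ∈-insert; ∈-filter⁺; ∈-filter⁻)
open import Data.List.Relation.Unary.Any using (here; there)
open import Data.List.Relation.Unary.All using (All; []; _∷_)
import Data.List.Relation.Unary.All as All
import Data.List.Relation.Unary.All.Properties as Allₚ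
open import Data.List.Relation.Unary.AllPairs as AllPairs using (AllPairs; []; _∷_)
import Data.List.Relation.Unary.AllPairs.Properties as AllPairsₚ
open import Data.List.Relation.Unary.Unique.Propositional using (Unique)
import Data.List.Relation.Unary.Unique.Propositional.Properties as Uniqueₚ
open import Data.List.Relation.Binary.Permutation.Propositional using (_↭_; ↭⇒↭ₛ; ↭-refl; ↭-sym; ↭-trans;
  ↭-reflexive; prep; swap; module PermutationReasoning)
open import Data.List.Relation.Binary.Permutation.Propositional.Properties using (↭-length; ↭-singleton-inv;
  ∈-resp-↭; map⁺; ↭-map-inv; ++⁺ʳ; drop-∷; shift; ∷↭∷ʳ; ↭-reverse; filter-↭)
open import Data.List.Relation.Binary.Permutation.Setoid.Properties using (Unique-resp-↭)
open import Data.Maybe as Maybe using (Maybe; just; nothing)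
open import Data.Product using (∃; ∃₂; _×_; _,_; proj₁; proj₂)
open import Data.Sum using (_⊎_; inj₁; inj₂)
open import Function using (_∘_)
open import Relation.Nullary using (¬_; yes; no; contradiction)
open import Relation.Binary.Definitions using (tri<; tri≈; tri>)
open import Relation.Binary.PropositionalEquality using (_≡_; _≢_; refl; sym; trans; cong; cong₂; subst; subst₂;
  setoid; module ≡-Reasoning)

-- One-line notation is 1-based, so the entry at the 0-based position i is σ ⟨ suc i ⟩.

⟨⟩-∈ : ∀ xs {i} → i < length xs → xs ⟨ suc i ⟩ ∈ xs
⟨⟩-∈ (x ∷ xs) {zero}  _       = here refl
⟨⟩-∈ (x ∷ xs) {suc i} (s≤s p) = there (⟨⟩-∈ xs p)

∈-⟨⟩ : ∀ {x xs} → x ∈ xs → ∃ λ i → i < length xs × xs ⟨ suc i ⟩ ≡ x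
∈-⟨⟩ (here refl) = 0 , s≤s z≤n , refl
∈-⟨⟩ (there p) with ∈-⟨⟩ p
... | i , i< , eq = suc i , s≤s i< , eq

⟨⟩-injective : ∀ {xs i j} → Unique xs → i < length xs → j < length xs →
  xs ⟨ suc i ⟩ ≡ xs ⟨ suc j ⟩ → i ≡ j
⟨⟩-injective {x ∷ xs} {zero}  {zero}  _        _       _       _  = refl
⟨⟩-injective {x ∷ xs} {zero}  {suc j} (h ∷ _)  _       (s≤s q) eq = contradiction eq (All.lookup h (⟨⟩-∈ xs q))
⟨⟩-injective {x ∷ xs} {suc i} {zero}  (h ∷ _)  (s≤s p) _       eq = contradiction (sym eq) (All.lookup h (⟨⟩-∈ xs p))
⟨⟩-injective {x ∷ xs} {suc i} {suc j} (_ ∷ u)  (s≤s p) (s≤s q) eq = cong suc (⟨⟩-injective u p q eq)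

⟨⟩-map : ∀ (f : ℕ → ℕ) xs {i} → i < length xs → map f xs ⟨ suc i ⟩ ≡ f (xs ⟨ suc i ⟩)
⟨⟩-map f (x ∷ xs) {zero}  _       = refl
⟨⟩-map f (x ∷ xs) {suc i} (s≤s p) = ⟨⟩-map f xs p

⟨⟩-++ˡ : ∀ xs ys {i} → i < length xs → (xs ++ ys) ⟨ suc i ⟩ ≡ xs ⟨ suc i ⟩
⟨⟩-++ˡ (x ∷ xs) ys {zero}  _       = refl
⟨⟩-++ˡ (x ∷ xs) ys {suc i} (s≤s p) = ⟨⟩-++ˡ xs ys p

⟨⟩-++-mid : ∀ xs {y ys} → (xs ++ y ∷ ys) ⟨ suc (length xs) ⟩ ≡ y
⟨⟩-++-mid []           = refl
⟨⟩-++-mid (x ∷ xs)     = ⟨⟩-++-mid xs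

⟨⟩-take : ∀ xs {t i} → i < t → take t xs ⟨ suc i ⟩ ≡ xs ⟨ suc i ⟩
⟨⟩-take []       {suc t} {i}     _       = refl
⟨⟩-take (x ∷ xs) {suc t} {zero}  _       = refl
⟨⟩-take (x ∷ xs) {suc t} {suc i} (s≤s p) = ⟨⟩-take xs p

take-suc-⟨⟩ : ∀ xs {t} → t < length xs → take (suc t) xs ≡ take t xs ∷ʳ xs ⟨ suc t ⟩
take-suc-⟨⟩ (x ∷ xs) {zero}  _       = refl
take-suc-⟨⟩ (x ∷ xs) {suc t} (s≤s p) = cong (x ∷_) (take-suc-⟨⟩ xs p)

snoc-last : ∀ {n} xs → length xs ≡ suc n → xs ≡ take n xs ∷ʳ xs ⟨ suc n ⟩
snoc-last {n} xs len = trans (sym (take-all (suc n) xs (≤-reflexive len))) (take-suc-⟨⟩ xs (≤-reflexive (sym len)))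

∈-take⁻ : ∀ {x t} xs → t ≤ length xs → x ∈ take t xs → ∃ λ i → i < t × xs ⟨ suc i ⟩ ≡ x
∈-take⁻ {t = t} xs t≤ x∈ with ∈-⟨⟩ x∈
... | i , i< , eq = i , i<t , trans (sym (⟨⟩-take xs i<t)) eq
  where
  i<t = subst (i <_) (trans (length-take t xs) (m≤n⇒m⊓n≡m t≤)) i<

∈-take⁺ : ∀ {t i} xs → t ≤ length xs → i < t → xs ⟨ suc i ⟩ ∈ take t xs
∈-take⁺ {t} {i} xs t≤ i<t = subst (_∈ take t xs) (⟨⟩-take xs i<t)
  (⟨⟩-∈ (take t xs) (subst (i <_) (sym (trans (length-take t xs) (m≤n⇒m⊓n≡m t≤))) i<t))

⟨⟩-applyUpTo : ∀ (f : ℕ → ℕ) {n i} → i < n → applyUpTo f n ⟨ suc i ⟩ ≡ f i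
⟨⟩-applyUpTo f {suc n} {zero}  _       = refl
⟨⟩-applyUpTo f {suc n} {suc i} (s≤s p) = ⟨⟩-applyUpTo (f ∘ suc) p

applyUpTo-cong : ∀ {A : Set} {f g : ℕ → A} n → (∀ i → i < n → f i ≡ g i) → applyUpTo f n ≡ applyUpTo g n
applyUpTo-cong zero    _  = refl
applyUpTo-cong (suc n) eq = cong₂ _∷_ (eq 0 (s≤s z≤n)) (applyUpTo-cong n (λ i i< → eq (suc i) (s≤s i<)))

applyUpTo-insert : ∀ {A : Set} (f g : ℕ → A) a {k n} → k ≤ n →
  (∀ i → i < k → f i ≡ g i) → f k ≡ a → (∀ i → k ≤ i → i < n → f (suc i) ≡ g i) →
  applyUpTo f (suc n) ≡ take k (applyUpTo g n) ++ a ∷ drop k (applyUpTo g n)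
applyUpTo-insert f g a {zero}  {n}     _       _  at after = cong₂ _∷_ at (applyUpTo-cong n (λ i → after i z≤n))
applyUpTo-insert f g a {suc k} {suc n} (s≤s p) lt at after = cong₂ _∷_ (lt 0 (s≤s z≤n))
  (applyUpTo-insert (f ∘ suc) (g ∘ suc) a p (λ i i< → lt (suc i) (s≤s i<)) at (λ i k≤ i< → after (suc i) (s≤s k≤) (s≤s i<)))

Unique-↭ : ∀ {xs ys : List ℕ} → xs ↭ ys → Unique xs → Unique ys
Unique-↭ p = Unique-resp-↭ (setoid ℕ) (↭⇒↭ₛ p)

-- The pigeonhole principle for a relation instead of a function: images need only exist, which
-- suits images obtained by case analysis.
injection-bound : ∀ {s t} (R : ℕ → ℕ → Set) → (∀ i → i < s → ∃ λ j → j < t × R i j) →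
  (∀ {i i′ j} → R i j → R i′ j → i ≡ i′) → s ≤ t
injection-bound {s} {t} R image inj = injective⇒≤ {f = f} λ {i} {j} eq → toℕ-injective
  (inj (rel i) (subst (R (toℕ j)) (trans (sym (toℕ-f j)) (trans (cong toℕ (sym eq)) (toℕ-f i))) (rel j)))
  where
  im : ∀ i → ∃ λ j → j < t × R (toℕ i) j
  im i = image (toℕ i) (toℕ<n i)
  f : Fin s → Fin t
  f i = fromℕ< (proj₁ (proj₂ (im i)))
  toℕ-f : ∀ i → toℕ (f i) ≡ proj₁ (im i)
  toℕ-f i = toℕ-fromℕ< (proj₁ (proj₂ (im i)))
  rel : ∀ i → R (toℕ i) (proj₁ (im i))
  rel i = proj₂ (proj₂ (im i))

-- Boolean comparisons and the order-preserving relabelling `lift`.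

<ᵇ-true : ∀ {x y} → x < y → (x <ᵇ y) ≡ true
<ᵇ-true {zero}  (s≤s _) = refl
<ᵇ-true {suc x} (s≤s p) = <ᵇ-true p

<ᵇ-false : ∀ {x y} → y ≤ x → (x <ᵇ y) ≡ false
<ᵇ-false {x}     {zero}  _       = refl
<ᵇ-false {suc x} {suc y} (s≤s p) = <ᵇ-false p

≡ᵇ-refl : ∀ x → (x ≡ᵇ x) ≡ true
≡ᵇ-refl zero    = refl
≡ᵇ-refl (suc x) = ≡ᵇ-refl x

≡ᵇ-false : ∀ {x y} → x ≢ y → (x ≡ᵇ y) ≡ false
≡ᵇ-false {zero}  {zero}  ne = contradiction refl ne
≡ᵇ-false {zero}  {suc y} ne = refl
≡ᵇ-false {suc x} {zero}  ne = refl
≡ᵇ-false {suc x} {suc y} ne = ≡ᵇ-false (ne ∘ cong suc)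

∈⇒elemᵇ : ∀ {x xs} → x ∈ xs → elemᵇ x xs ≡ true
∈⇒elemᵇ {x} (here refl) rewrite ≡ᵇ-refl x = refl
∈⇒elemᵇ {x} {y ∷ _} (there p) with y ≡ᵇ x
... | true  = refl
... | false = ∈⇒elemᵇ p

∉⇒elemᵇ : ∀ {x} xs → x ∉ xs → elemᵇ x xs ≡ false
∉⇒elemᵇ []       _ = refl
∉⇒elemᵇ {x} (y ∷ ys) n rewrite ≡ᵇ-false (λ (eq : y ≡ x) → n (here (sym eq))) = ∉⇒elemᵇ ys (n ∘ there)

elemᵇ⇒∈ : ∀ {x} xs → elemᵇ x xs ≡ true → x ∈ xs
elemᵇ⇒∈ {x} (y ∷ ys) eq with y ≟ x
... | yes refl = here refl
... | no ne rewrite ≡ᵇ-false ne = there (elemᵇ⇒∈ ys eq)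

-- shiftFrom b is map (lift b) by computation.
lift : ℕ → ℕ → ℕ
lift b x = if b ≤ᵇ x then suc x else x

lift-≥ : ∀ {b x} → b ≤ x → lift b x ≡ suc x
lift-≥ {zero}  _ = refl
lift-≥ {suc b} p rewrite <ᵇ-true p = refl

lift-< : ∀ {b x} → x < b → lift b x ≡ x
lift-< {suc b} (s≤s p) rewrite <ᵇ-false p = refl

lift-mono : ∀ b {x y} → x < y → lift b x < lift b y
lift-mono b {x} {y} x<y with b ≤? x | b ≤? y
... | yes p | yes q rewrite lift-≥ p | lift-≥ q = s≤s x<y
... | yes p | no q  = contradiction (≤-trans p (<⇒≤ x<y)) q
... | no p  | yes q rewrite lift-< (≰⇒> p) | lift-≥ q = m<n⇒m<1+n x<y
... | no p  | no q  rewrite lift-< (≰⇒> p) | lift-< (≰⇒> q) = x<y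

lift-mono⁻ : ∀ b {x y} → lift b x < lift b y → x < y
lift-mono⁻ b {x} {y} l with <-cmp x y
... | tri< p _ _    = p
... | tri≈ _ refl _ = contradiction l (<-irrefl refl)
... | tri> _ _ q    = contradiction l (<-asym (lift-mono b q))

lift-injective : ∀ b {x y} → lift b x ≡ lift b y → x ≡ y
lift-injective b {x} {y} eq with <-cmp x y
... | tri< p _ _ = contradiction (lift-mono b p) (<-irrefl eq)
... | tri≈ _ e _ = e
... | tri> _ _ q = contradiction (lift-mono b q) (<-irrefl (sym eq))

<-lift : ∀ {b x} → b < lift b x → b ≤ x
<-lift {b} {x} l with b ≤? x
... | yes p = p
... | no p  = contradiction (<⇒≤ (≰⇒> p)) (<⇒≱ (subst (b <_) (lift-< (≰⇒> p)) l))

lift-≤ : ∀ b x → lift b x ≤ suc x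
lift-≤ b x with b ≤? x
... | yes p rewrite lift-≥ p = ≤-refl
... | no p  rewrite lift-< (≰⇒> p) = n≤1+n x

lift-<ᵇ : ∀ b x y → (lift b x <ᵇ lift b y) ≡ (x <ᵇ y)
lift-<ᵇ b x y with x <? y
... | yes p rewrite <ᵇ-true p = <ᵇ-true (lift-mono b p)
... | no p  rewrite <ᵇ-false (≮⇒≥ p) = <ᵇ-false (≮⇒≥ (p ∘ lift-mono⁻ b))

-- Permutations as bijections between positions and values.

record IsBijection (n : ℕ) (σ : List ℕ) : Set where
  field
    len        : length σ ≡ n
    unique     : Unique σ
    positive   : ∀ {i} → i < n → 1 ≤ σ ⟨ suc i ⟩
    bounded    : ∀ {i} → i < n → σ ⟨ suc i ⟩ ≤ n
    injective  : ∀ {i j} → i < n → j < n → σ ⟨ suc i ⟩ ≡ σ ⟨ suc j ⟩ → i ≡ j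
    surjective : ∀ {c} → 1 ≤ c → c ≤ n → ∃ λ i → i < n × σ ⟨ suc i ⟩ ≡ c

∈-[1…] : ∀ {n c} → 1 ≤ c → c ≤ n → c ∈ [1… n ]
∈-[1…] {c = suc c} _ p = ∈-applyUpTo⁺ suc p

[1…]-bounds : ∀ {n c} → c ∈ [1… n ] → 1 ≤ c × c ≤ n
[1…]-bounds p with ∈-applyUpTo⁻ suc p
... | i , i< , refl = s≤s z≤n , i<

[1…]-unique : ∀ n → Unique [1… n ]
[1…]-unique n = Uniqueₚ.applyUpTo⁺₁ suc n λ i<j _ eq → <-irrefl (suc-injective eq) i<j

IsPerm-unique : ∀ {n σ} → IsPerm n σ → Unique σ
IsPerm-unique {n} p = Unique-↭ (↭-sym p) ([1…]-unique n)

IsPerm-length : ∀ {n σ} → IsPerm n σ → length σ ≡ n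
IsPerm-length {n} p = trans (↭-length p) (length-applyUpTo suc n)

IsPerm⇒bijection : ∀ {n σ} → IsPerm n σ → IsBijection n σ
IsPerm⇒bijection {n} {σ} p = record
  { len        = l
  ; unique     = IsPerm-unique p
  ; positive   = λ i< → proj₁ (bounds i<)
  ; bounded    = λ i< → proj₂ (bounds i<)
  ; injective  = λ i< j< → ⟨⟩-injective (IsPerm-unique p) (≤-trans i< (≤-reflexive (sym l))) (≤-trans j< (≤-reflexive (sym l)))
  ; surjective = onto
  }
  where
  l = IsPerm-length p
  bounds : ∀ {i} → i < n → 1 ≤ σ ⟨ suc i ⟩ × σ ⟨ suc i ⟩ ≤ n
  bounds i< = [1…]-bounds (∈-resp-↭ p (⟨⟩-∈ σ (≤-trans i< (≤-reflexive (sym l)))))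
  onto : ∀ {c} → 1 ≤ c → c ≤ n → ∃ λ i → i < n × σ ⟨ suc i ⟩ ≡ c
  onto a b with ∈-⟨⟩ (∈-resp-↭ (↭-sym p) (∈-[1…] a b))
  ... | i , i< , eq = i , subst (i <_) l i< , eq

insert-[1…] : ∀ {n v} → 1 ≤ v → v ≤ suc n → v ∷ map (lift v) [1… n ] ↭ [1… suc n ]
insert-[1…] {n} {suc k} _ (s≤s k≤n) = ↭-sym (↭-trans (↭-reflexive eq)
  (↭-trans (shift (suc k) (take k xs) (drop k xs)) (↭-reflexive (cong (suc k ∷_) (take++drop≡id k xs)))))
  where
  xs = map (lift (suc k)) [1… n ]
  eq : [1… suc n ] ≡ take k xs ++ suc k ∷ drop k xs
  eq rewrite map-applyUpTo suc (lift (suc k)) n = applyUpTo-insert suc (lift (suc k) ∘ suc) (suc k) k≤n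
    (λ i i< → sym (lift-< (s≤s i<))) refl (λ i k≤ _ → sym (lift-≥ (s≤s k≤)))

-- 321-avoiding permutations

No321 : ℕ → List ℕ → Set
No321 n σ = ∀ {i j k} → i < j → j < k → k < n → σ ⟨ suc k ⟩ < σ ⟨ suc j ⟩ → σ ⟨ suc j ⟩ < σ ⟨ suc i ⟩ → ⊥

Avoids321⇒No321 : ∀ {n σ} → length σ ≡ n → Avoids321 σ → No321 n σ
Avoids321⇒No321 refl av i<j j<k k<n a b = av _ _ _ (s≤s z≤n) (s≤s i<j) (s≤s j<k) k<n (a , b)

No321⇒Avoids321 : ∀ {n σ} → length σ ≡ n → No321 n σ → Avoids321 σ
No321⇒Avoids321 refl av (suc i) (suc j) (suc k) _ (s≤s i<j) (s≤s j<k) k≤n (a , b) = av i<j j<k k≤n a b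

-- Suppose a larger entry stands before the excedance `e`. Each of the `e + 1` values up to `suc e`
-- is below `σ ⟨ suc e ⟩`, so if it stood after `e` it would complete a 321. All of them would then
-- have to fit into the `e` positions before `e`.
excedance-is-record : ∀ {n σ} → IsBijection n σ → No321 n σ → ∀ {p e} → p < e → e < n →
  suc e < σ ⟨ suc e ⟩ → σ ⟨ suc p ⟩ < σ ⟨ suc e ⟩
excedance-is-record {n} {σ} bij av {p} {e} p<e e<n exc with <-cmp (σ ⟨ suc p ⟩) (σ ⟨ suc e ⟩)
... | tri< lt _ _ = lt
... | tri≈ _ eq _ = contradiction (IsBijection.injective bij (<-trans p<e e<n) e<n eq) (<⇒≢ p<e)
... | tri> _ _ gt = contradiction
  (injection-bound (λ c q → σ ⟨ suc q ⟩ ≡ suc c) early (λ a b → suc-injective (trans (sym a) b))) (<⇒≱ (n<1+n e))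
  where
  early : ∀ c → c < suc e → ∃ λ q → q < e × σ ⟨ suc q ⟩ ≡ suc c
  early c c<  with IsBijection.surjective bij (s≤s (z≤n {c})) (≤-trans c< e<n)
  ... | q , q<n , eq with <-cmp q e
  ...   | tri< lt _ _   = q , lt , eq
  ...   | tri≈ _ refl _ = contradiction exc (≤⇒≯ (≤-trans (≤-reflexive eq) c<))
  ...   | tri> _ _ e<q  = ⊥-elim (av p<e e<q q<n (≤-<-trans (≤-trans (≤-reflexive eq) c<) exc) gt)

-- If a smaller entry stood at `q`, every entry before `a` would have to lie below `σ ⟨ suc a ⟩`, as
-- otherwise it would start a 321. Together with the entry at `q` these are `a + 1` distinct values
-- below `σ ⟨ suc a ⟩ ≤ suc a`, where only `a` are available.
nonExcedance-below : ∀ {n σ} → IsBijection n σ → No321 n σ → ∀ {a q} → a < q → q < n →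
  σ ⟨ suc a ⟩ ≤ suc a → σ ⟨ suc a ⟩ < σ ⟨ suc q ⟩
nonExcedance-below {n} {σ} bij av {a} {q} a<q q<n non with <-cmp (σ ⟨ suc a ⟩) (σ ⟨ suc q ⟩)
... | tri< lt _ _ = lt
... | tri≈ _ eq _ = contradiction (IsBijection.injective bij (<-trans a<q q<n) q<n eq) (<⇒≢ a<q)
... | tri> _ _ gt = contradiction (≤-trans (s≤s (injection-bound R image inj)) (≤-reflexive (suc-pred (σ ⟨ suc a ⟩) {{>-nonZero (IsBijection.positive bij a<n)}}))) (≤⇒≯ non)
  where
  a<n = <-trans a<q q<n
  -- The `a + 1` positions being counted: the slots below `a` stand for themselves, and slot `a`
  -- stands for `q`.
  Source : ℕ → ℕ → Set
  Source i p = (i < a × p ≡ i) ⊎ (i ≡ a × p ≡ q)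
  R : ℕ → ℕ → Set
  R i c = ∃ λ p → Source i p × p < n × σ ⟨ suc p ⟩ ≡ suc c
  value : ∀ {i p} → Source i p → p < n → σ ⟨ suc p ⟩ < σ ⟨ suc a ⟩ →
    ∃ λ c → c < pred (σ ⟨ suc a ⟩) × R i c
  value {i} {p} src p<n lt = pred (σ ⟨ suc p ⟩) , pred-mono-< {{>-nonZero (IsBijection.positive bij p<n)}} lt ,
    p , src , p<n , sym (suc-pred (σ ⟨ suc p ⟩) {{>-nonZero (IsBijection.positive bij p<n)}})
  image : ∀ i → i < suc a → ∃ λ c → c < pred (σ ⟨ suc a ⟩) × R i c
  image i (s≤s i≤a) with <-cmp i a
  ... | tri≈ _ i≡a _ = value (inj₂ (i≡a , refl)) q<n gt
  ... | tri> _ _ a<i = contradiction i≤a (<⇒≱ a<i)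
  ... | tri< i<a _ _ with <-cmp (σ ⟨ suc i ⟩) (σ ⟨ suc a ⟩)
  ...   | tri< lt _ _ = value (inj₁ (i<a , refl)) (<-trans i<a a<n) lt
  ...   | tri≈ _ eq _ = contradiction (IsBijection.injective bij (<-trans i<a a<n) a<n eq) (<⇒≢ i<a)
  ...   | tri> _ _ g  = ⊥-elim (av i<a a<q q<n gt g)
  inj : ∀ {i i′ c} → R i c → R i′ c → i ≡ i′
  inj (p , src , p<n , eq) (p′ , src′ , p′<n , eq′) with IsBijection.injective bij p<n p′<n (trans eq (sym eq′))
  inj (p , inj₁ (_ , refl) , _) (_ , inj₁ (_ , refl) , _)     | refl = refl
  inj (p , inj₁ (i< , refl) , _) (_ , inj₂ (_ , refl) , _)    | refl = contradiction (<-trans i< a<q) (<-irrefl refl)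
  inj (p , inj₂ (_ , refl) , _) (_ , inj₁ (i< , refl) , _)    | refl = contradiction (<-trans i< a<q) (<-irrefl refl)
  inj (p , inj₂ (refl , refl) , _) (_ , inj₂ (refl , _) , _)  | refl = refl

-- Row insertion on two rows

data RowInsertion (x : ℕ) : List ℕ → Maybe ℕ × List ℕ → Set where
  append : ∀ {r} → All (_< x) r → RowInsertion x r (nothing , r ∷ʳ x)
  bump   : ∀ {y} A B → All (_< x) A → x < y → RowInsertion x (A ++ y ∷ B) (just y , A ++ x ∷ B)

rowIns-spec : ∀ x r → x ∉ r → RowInsertion x r (rowIns x r)
rowIns-spec x []       _ = append []
rowIns-spec x (y ∷ ys) x∉ with x <? y
... | yes x<y rewrite <ᵇ-true x<y = bump [] ys [] x<y
... | no x≮y rewrite <ᵇ-false (≮⇒≥ x≮y) with rowIns x ys | rowIns-spec x ys (x∉ ∘ there)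
...   | _ | append all          = append (≤∧≢⇒< (≮⇒≥ x≮y) (λ eq → x∉ (here (sym eq))) ∷ all)
...   | _ | bump A B all x<z    = bump (y ∷ A) B (≤∧≢⇒< (≮⇒≥ x≮y) (λ eq → x∉ (here (sym eq))) ∷ all) x<z

rowIns-append : ∀ {x r} → All (_< x) r → rowIns x r ≡ (nothing , r ∷ʳ x)
rowIns-append []       = refl
rowIns-append {x} {y ∷ ys} (p ∷ ps) rewrite <ᵇ-false (<⇒≤ p) | rowIns-append ps = refl

State : Set
State = Tableau × Tableau × ℕ

row₁ row₂ times₂ : State → List ℕ
row₁ (P , _ , _)   = rowOf 0 P
row₂ (P , _ , _)   = rowOf 1 P
times₂ (_ , Q , _) = rowOf 1 Q

clock : State → ℕ
clock (_ , _ , i) = i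

-- Fixing the number of rows of both tableaux at once lets `tabIns` and `addAt` compute, and records
-- that no third row appears.
data Shape : State → Set where
  empty : ∀ {i} → Shape ([] , [] , i)
  one   : ∀ {r q i} → Shape (r ∷ [] , q ∷ [] , i)
  two   : ∀ {r r′ q q′ i} → Shape (r ∷ r′ ∷ [] , q ∷ q′ ∷ [] , i)

data Step (s : State) (x : ℕ) (s′ : State) : Set where
  append : All (_< x) (row₁ s) → row₁ s′ ≡ row₁ s ∷ʳ x → row₂ s′ ≡ row₂ s → times₂ s′ ≡ times₂ s → Step s x s′
  bump   : ∀ {y} A B → All (_< x) A → x < y → row₁ s ≡ A ++ y ∷ B → row₁ s′ ≡ A ++ x ∷ B →
           row₂ s′ ≡ row₂ s ∷ʳ y → times₂ s′ ≡ times₂ s ∷ʳ suc (clock s) → Step s x s′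

-- The last hypothesis says that anything `x` can bump exceeds the whole second row, so the bumped
-- entry is appended there and bumps nothing further.
rsStep-spec : ∀ {s x} → Shape s → x ∉ row₁ s →
  (∀ {y z} → y ∈ row₁ s → x < y → z ∈ row₂ s → z < y) →
  Shape (rsStep s x) × clock (rsStep s x) ≡ suc (clock s) × Step s x (rsStep s x)
rsStep-spec empty _ _ = one , refl , append [] refl refl refl
rsStep-spec {_} {x} (one {r}) x∉ _ with rowIns x r | rowIns-spec x r x∉
... | _ | append all       = one , refl , append all refl refl refl
... | _ | bump A B all x<y = two , refl , bump A B all x<y refl refl refl refl
rsStep-spec {_} {x} (two {r} {r′}) x∉ sep with rowIns x r | rowIns-spec x r x∉
... | _ | append all       = two , refl , append all refl refl refl
... | _ | bump {y} A B all x<y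
  rewrite rowIns-append {y} {r′} (All.tabulate (sep (∈-insert A) x<y)) = two , refl , bump A B all x<y refl refl refl refl

Unique-++-disjoint : ∀ {z : ℕ} xs {ys} → Unique (xs ++ ys) → z ∈ xs → z ∉ ys
Unique-++-disjoint (x ∷ xs) (h ∷ u) (here refl) z∈ = All.lookup h (∈-++⁺ʳ xs z∈) refl
Unique-++-disjoint (x ∷ xs) (h ∷ u) (there p)   z∈ = Unique-++-disjoint xs u p z∈

sorted-replace : ∀ {x y} A {B} → AllPairs _<_ (A ++ y ∷ B) → All (_< x) A → x < y → AllPairs _<_ (A ++ x ∷ B)
sorted-replace []      (h ∷ s) _        x<y = All.map (<-trans x<y) h ∷ s
sorted-replace (a ∷ A) (h ∷ s) (p ∷ ps) x<y with Allₚ.++⁻ A h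
... | hA , _ ∷ hB = Allₚ.++⁺ hA (p ∷ hB) ∷ sorted-replace A s ps x<y

sorted-above : ∀ {y z} A {B} → AllPairs _<_ (A ++ y ∷ B) → z ∈ B → y < z
sorted-above []      (h ∷ _) z∈ = All.lookup h z∈
sorted-above (a ∷ A) (_ ∷ s) z∈ = sorted-above A s z∈

∈-∷ʳ⁻ : ∀ {z x : ℕ} xs → z ∈ xs ∷ʳ x → z ∈ xs ⊎ z ≡ x
∈-∷ʳ⁻ xs z∈ with ∈-++⁻ xs z∈
... | inj₁ p         = inj₁ p
... | inj₂ (here eq) = inj₂ eq

∈-replace⁻ : ∀ {x z : ℕ} A {B} → z ∈ A ++ x ∷ B → z ≡ x ⊎ (z ∈ A ⊎ z ∈ B)
∈-replace⁻ A z∈ with ∈-++⁻ A z∈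
... | inj₁ p           = inj₂ (inj₁ p)
... | inj₂ (here eq)   = inj₁ eq
... | inj₂ (there p)   = inj₂ (inj₂ p)

state : List ℕ → ℕ → State
state σ t = foldl rsStep ([] , [] , 0) (take t σ)

state-suc : ∀ σ {t} → t < length σ → state σ (suc t) ≡ rsStep (state σ t) (σ ⟨ suc t ⟩)
state-suc σ {t} t< rewrite take-suc-⟨⟩ σ t< = foldl-∷ʳ rsStep _ (σ ⟨ suc t ⟩) (take t σ)

-- separation: the entry that bumped z out of the first row was at least y,
-- since otherwise y would have been bumped in place of z.
record RowInvariant (σ : List ℕ) (t : ℕ) (s : State) : Set where
  field
    shape      : Shape s
    synced     : clock s ≡ t
    entries    : row₁ s ++ row₂ s ↭ take t σ
    sorted     : AllPairs _<_ (row₁ s)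
    separation : ∀ {y z} → z ∈ row₂ s → y ∈ row₁ s → y < z →
      ∃₂ λ p q → p < q × q < t × σ ⟨ suc p ⟩ ≡ z × y ≤ σ ⟨ suc q ⟩ × σ ⟨ suc q ⟩ < z
    displaced  : ∀ {z} → z ∈ row₂ s →
      ∃₂ λ p q → p < q × q < t × σ ⟨ suc p ⟩ ≡ z × σ ⟨ suc q ⟩ < z
    inversion  : ∀ {p q} → p < q → q < t → σ ⟨ suc q ⟩ < σ ⟨ suc p ⟩ →
      ∃ λ z → z ∈ row₂ s × σ ⟨ suc q ⟩ < z
    times-≤    : All (_≤ t) (times₂ s)

entries-append : ∀ (r₁ r₂ : List ℕ) {x xs} → r₁ ++ r₂ ↭ xs → (r₁ ∷ʳ x) ++ r₂ ↭ xs ∷ʳ x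
entries-append r₁ r₂ {x} {xs} p = begin
  (r₁ ∷ʳ x) ++ r₂   ≡⟨ ++-assoc r₁ [ x ] r₂ ⟩
  r₁ ++ x ∷ r₂      ↭⟨ shift x r₁ r₂ ⟩
  x ∷ r₁ ++ r₂      ↭⟨ ∷↭∷ʳ x (r₁ ++ r₂) ⟩
  (r₁ ++ r₂) ∷ʳ x   ↭⟨ ++⁺ʳ [ x ] p ⟩
  xs ∷ʳ x           ∎
  where open PermutationReasoning

entries-bump : ∀ (A B r₂ : List ℕ) {x y xs} → (A ++ y ∷ B) ++ r₂ ↭ xs → (A ++ x ∷ B) ++ (r₂ ∷ʳ y) ↭ xs ∷ʳ x
entries-bump A B r₂ {x} {y} {xs} p = begin
  (A ++ x ∷ B) ++ (r₂ ∷ʳ y)     ≡⟨ sym (++-assoc (A ++ x ∷ B) r₂ [ y ]) ⟩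
  ((A ++ x ∷ B) ++ r₂) ∷ʳ y     ↭⟨ ↭-sym (∷↭∷ʳ y _) ⟩
  y ∷ (A ++ x ∷ B) ++ r₂        ↭⟨ prep y (++⁺ʳ r₂ (shift x A B)) ⟩
  y ∷ x ∷ (A ++ B) ++ r₂        ↭⟨ swap y x ↭-refl ⟩
  x ∷ y ∷ (A ++ B) ++ r₂        ↭⟨ prep x (++⁺ʳ r₂ (↭-sym (shift y A B))) ⟩
  x ∷ (A ++ y ∷ B) ++ r₂        ↭⟨ prep x p ⟩
  x ∷ xs                        ↭⟨ ∷↭∷ʳ x xs ⟩
  xs ∷ʳ x                       ∎
  where open PermutationReasoning

module _ {n σ} (bij : IsBijection n σ) (av : No321 n σ) where
  open IsBijection bij

  private
    <-len : ∀ {t} → t < n → t < length σ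
    <-len t<n = ≤-trans t<n (≤-reflexive (sym len))

  module _ {t s} (t<n : t < n) (inv : RowInvariant σ t s) where
    open RowInvariant inv

    private x = σ ⟨ suc t ⟩

    entry-position : ∀ {z} → z ∈ row₁ s ++ row₂ s → ∃ λ p → p < t × σ ⟨ suc p ⟩ ≡ z
    entry-position z∈ = ∈-take⁻ σ (<⇒≤ (<-len t<n)) (∈-resp-↭ entries z∈)

    fresh : x ∉ row₁ s ++ row₂ s
    fresh x∈ with entry-position x∈
    ... | p , p<t , eq = <⇒≢ p<t (injective (<-trans p<t t<n) t<n eq)

    rows-unique : Unique (row₁ s ++ row₂ s)
    rows-unique = Unique-↭ (↭-sym entries) (Uniqueₚ.take⁺ t unique)
    -- If `y < z`, separation supplies an earlier descent from `z` to an entry at least `y`, hence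
    -- above `x`; with `x` this is a 321.
    bumped-above : ∀ {y z} → y ∈ row₁ s → x < y → z ∈ row₂ s → z < y
    bumped-above {y} {z} y∈ x<y z∈ with <-cmp z y
    ... | tri< lt _ _   = lt
    ... | tri≈ _ refl _ = contradiction z∈ (Unique-++-disjoint (row₁ s) rows-unique y∈)
    ... | tri> _ _ y<z with separation z∈ y∈ y<z
    ...   | p , q , p<q , q<t , refl , y≤ , <z = ⊥-elim (av p<q q<t t<n (<-≤-trans x<y y≤) <z)

    step-spec : Shape (rsStep s x) × clock (rsStep s x) ≡ suc (clock s) × Step s x (rsStep s x)
    step-spec = rsStep-spec shape (fresh ∘ ∈-++⁺ˡ) bumped-above

    -- For pairs that are new, `x` itself is the smaller, later witness in `separation` and
    -- `displaced`. When `y` is bumped, the entries kept to its left are below `x`, and those to its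
    -- right exceed `y`, so nothing is claimed about them. For `inversion`, a larger partner of an
    -- appended `x` cannot be in the first row and so is already in the second; if `x` bumps `y`,
    -- then `y` serves.
    step-preserves : ∀ {s′} → Shape s′ → clock s′ ≡ suc (clock s) → Step s x s′ → RowInvariant σ (suc t) s′
    step-preserves sh ck (append all e₁ e₂ eq) = record
      { shape      = sh
      ; synced     = trans ck (cong suc synced)
      ; entries    = subst₂ _↭_ (sym (cong₂ _++_ e₁ e₂)) (sym (take-suc-⟨⟩ σ (<-len t<n))) (entries-append (row₁ s) (row₂ s) entries)
      ; sorted     = subst (AllPairs _<_) (sym e₁) (AllPairsₚ.++⁺ sorted ([] ∷ []) (All.map (_∷ []) all))
      ; separation = λ z∈ y∈ → sep (subst (_ ∈_) e₂ z∈) (∈-∷ʳ⁻ (row₁ s) (subst (_ ∈_) e₁ y∈))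
      ; displaced  = λ z∈ → dis (subst (_ ∈_) e₂ z∈)
      ; inversion  = λ p<q q≤t lt → subst (λ r → ∃ λ z → z ∈ r × _ < z) (sym e₂) (invs p<q q≤t lt)
      ; times-≤    = subst (All (_≤ suc t)) (sym eq) (All.map m≤n⇒m≤1+n times-≤)
      }
      where
      sep : ∀ {y z} → z ∈ row₂ s → y ∈ row₁ s ⊎ y ≡ x → y < z →
        ∃₂ λ p q → p < q × q < suc t × σ ⟨ suc p ⟩ ≡ z × y ≤ σ ⟨ suc q ⟩ × σ ⟨ suc q ⟩ < z
      sep z∈ (inj₁ y∈) y<z with separation z∈ y∈ y<z
      ... | p , q , p<q , q<t , rest = p , q , p<q , m<n⇒m<1+n q<t , rest
      sep z∈ (inj₂ refl) x<z with entry-position (∈-++⁺ʳ (row₁ s) z∈)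
      ... | p , p<t , at = p , t , p<t , n<1+n t , at , ≤-refl , x<z
      dis : ∀ {z} → z ∈ row₂ s → ∃₂ λ p q → p < q × q < suc t × σ ⟨ suc p ⟩ ≡ z × σ ⟨ suc q ⟩ < z
      dis z∈ with displaced z∈
      ... | p , q , p<q , q<t , rest = p , q , p<q , m<n⇒m<1+n q<t , rest
      invs : ∀ {p q} → p < q → q < suc t → σ ⟨ suc q ⟩ < σ ⟨ suc p ⟩ → ∃ λ z → z ∈ row₂ s × σ ⟨ suc q ⟩ < z
      invs {p} p<q (s≤s q≤t) lt with m≤n⇒m<n∨m≡n q≤t
      ... | inj₁ q<t  = inversion p<q q<t lt
      ... | inj₂ refl with ∈-++⁻ (row₁ s) (∈-resp-↭ (↭-sym entries) (∈-take⁺ σ (<⇒≤ (<-len t<n)) p<q))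
      ...   | inj₁ p∈ = contradiction lt (<-asym (All.lookup all p∈))
      ...   | inj₂ p∈ = _ , p∈ , lt
    step-preserves sh ck (bump {y} A B all x<y e e₁ e₂ eq) = record
      { shape      = sh
      ; synced     = trans ck (cong suc synced)
      ; entries    = subst₂ _↭_ (sym (cong₂ _++_ e₁ e₂)) (sym (take-suc-⟨⟩ σ (<-len t<n)))
                       (entries-bump A B (row₂ s) (subst (λ r → r ++ row₂ s ↭ take t σ) e entries))
      ; sorted     = subst (AllPairs _<_) (sym e₁) (sorted-replace A sorted′ all x<y)
      ; separation = λ z∈ y∈ → sep (∈-∷ʳ⁻ (row₂ s) (subst (_ ∈_) e₂ z∈)) (∈-replace⁻ A (subst (_ ∈_) e₁ y∈))
      ; displaced  = λ z∈ → dis (∈-∷ʳ⁻ (row₂ s) (subst (_ ∈_) e₂ z∈))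
      ; inversion  = λ p<q q≤t lt → subst (λ r → ∃ λ z → z ∈ r × _ < z) (sym e₂) (invs p<q q≤t lt)
      ; times-≤    = subst (All (_≤ suc t)) (sym eq) (Allₚ.++⁺ (All.map m≤n⇒m≤1+n times-≤) (≤-reflexive (cong suc synced) ∷ []))
      }
      where
      sorted′ : AllPairs _<_ (A ++ y ∷ B)
      sorted′ = subst (AllPairs _<_) e sorted
      y-position : ∃ λ p → p < t × σ ⟨ suc p ⟩ ≡ y
      y-position = entry-position (∈-++⁺ˡ (subst (y ∈_) (sym e) (∈-insert A)))
      sep : ∀ {y′ z} → z ∈ row₂ s ⊎ z ≡ y → y′ ≡ x ⊎ (y′ ∈ A ⊎ y′ ∈ B) → y′ < z →
        ∃₂ λ p q → p < q × q < suc t × σ ⟨ suc p ⟩ ≡ z × y′ ≤ σ ⟨ suc q ⟩ × σ ⟨ suc q ⟩ < z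
      sep (inj₁ z∈) (inj₁ refl) x<z with entry-position (∈-++⁺ʳ (row₁ s) z∈)
      ... | p , p<t , at = p , t , p<t , n<1+n t , at , ≤-refl , x<z
      sep (inj₁ z∈) (inj₂ old) y<z with separation z∈ (subst (_ ∈_) (sym e) (case-∈ old)) y<z
        where
        case-∈ : ∀ {y′} → y′ ∈ A ⊎ y′ ∈ B → y′ ∈ A ++ y ∷ B
        case-∈ (inj₁ p) = ∈-++⁺ˡ p
        case-∈ (inj₂ p) = ∈-++⁺ʳ A (there p)
      ... | p , q , p<q , q<t , rest = p , q , p<q , m<n⇒m<1+n q<t , rest
      sep (inj₂ refl) (inj₁ refl) _ with y-position
      ... | p , p<t , at = p , t , p<t , n<1+n t , at , ≤-refl , x<y
      sep (inj₂ refl) (inj₂ (inj₁ y′∈)) _ with y-position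
      ... | p , p<t , at = p , t , p<t , n<1+n t , at , <⇒≤ (All.lookup all y′∈) , x<y
      sep (inj₂ refl) (inj₂ (inj₂ y′∈)) y′<y = contradiction y′<y (<-asym (sorted-above A sorted′ y′∈))
      dis : ∀ {z} → z ∈ row₂ s ⊎ z ≡ y → ∃₂ λ p q → p < q × q < suc t × σ ⟨ suc p ⟩ ≡ z × σ ⟨ suc q ⟩ < z
      dis (inj₁ z∈) with displaced z∈
      ... | p , q , p<q , q<t , rest = p , q , p<q , m<n⇒m<1+n q<t , rest
      dis (inj₂ refl) with y-position
      ... | p , p<t , at = p , t , p<t , n<1+n t , at , x<y
      invs : ∀ {p q} → p < q → q < suc t → σ ⟨ suc q ⟩ < σ ⟨ suc p ⟩ → ∃ λ z → z ∈ row₂ s ∷ʳ y × σ ⟨ suc q ⟩ < z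
      invs p<q (s≤s q≤t) lt with m≤n⇒m<n∨m≡n q≤t
      ... | inj₂ refl = y , ∈-++⁺ʳ (row₂ s) (here refl) , x<y
      ... | inj₁ q<t with inversion p<q q<t lt
      ...   | z , z∈ , lt′ = z , ∈-++⁺ˡ z∈ , lt′

    step-invariant : RowInvariant σ (suc t) (rsStep s x)
    step-invariant = let sh , ck , step = step-spec in step-preserves sh ck step

  invariant : ∀ t → t ≤ n → RowInvariant σ t (state σ t)
  invariant zero _ = record
    { shape = empty ; synced = refl ; entries = ↭-refl ; sorted = []
    ; separation = λ () ; displaced = λ () ; inversion = λ _ () ; times-≤ = [] }
  invariant (suc t) t<n = subst (RowInvariant σ (suc t)) (sym (state-suc σ (<-len t<n)))
    (step-invariant t<n (invariant t (<⇒≤ t<n)))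

-- The matching algorithm computes the second row

range : ℕ → ℕ → List ℕ
range t zero    = []
range t (suc k) = suc t ∷ range (suc t) k

applyUpTo-range : ∀ (f : ℕ → ℕ) t k → (∀ i → f i ≡ suc (t + i)) → applyUpTo f k ≡ range t k
applyUpTo-range f t zero    _  = refl
applyUpTo-range f t (suc k) eq = cong₂ _∷_ (trans (eq 0) (cong suc (+-identityʳ t)))
  (applyUpTo-range (f ∘ suc) (suc t) k (λ i → trans (eq (suc i)) (cong suc (+-suc t i))))

module _ {n σ} (bij : IsBijection n σ) (av : No321 n σ) where
  open IsBijection bij

  private
    rows-at : ℕ → State
    rows-at = state σ

    nonExc? = λ i → σ ⟨ i ⟩ ≤? i

  step-at : ∀ {t} → t < n → Step (rows-at t) (σ ⟨ suc t ⟩) (rows-at (suc t))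
  step-at {t} t<n = subst (Step (rows-at t) (σ ⟨ suc t ⟩)) (sym (state-suc σ (≤-trans t<n (≤-reflexive (sym len)))))
    (proj₂ (proj₂ (step-spec bij av t<n (invariant bij av t (<⇒≤ t<n)))))

  row₁-position : ∀ {t y} → t ≤ n → y ∈ row₁ (rows-at t) → ∃ λ p → p < t × σ ⟨ suc p ⟩ ≡ y
  row₁-position {t} t≤n y∈ = ∈-take⁻ σ (≤-trans t≤n (≤-reflexive (sym len)))
    (∈-resp-↭ (RowInvariant.entries (invariant bij av t t≤n)) (∈-++⁺ˡ y∈))

  append-at : ∀ {t} → t < n → (∀ {y} → y ∈ row₁ (rows-at t) → ¬ (σ ⟨ suc t ⟩ < y)) →
    row₁ (rows-at (suc t)) ≡ row₁ (rows-at t) ∷ʳ σ ⟨ suc t ⟩ × row₂ (rows-at (suc t)) ≡ row₂ (rows-at t)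
  append-at t<n none with step-at t<n
  ... | append _ e₁ e₂ _          = e₁ , e₂
  ... | bump A _ _ x<y e _ _ _    = contradiction x<y (none (subst (_ ∈_) (sym e) (∈-insert A)))

  bump-at : ∀ {t y} → t < n → y ∈ row₁ (rows-at t) → σ ⟨ suc t ⟩ < y →
    (∀ {z} → z ∈ row₁ (rows-at t) → σ ⟨ suc t ⟩ < z → y ≤ z) →
    ∃₂ λ A B → row₁ (rows-at t) ≡ A ++ y ∷ B × All (_< σ ⟨ suc t ⟩) A ×
      row₁ (rows-at (suc t)) ≡ A ++ σ ⟨ suc t ⟩ ∷ B × row₂ (rows-at (suc t)) ≡ row₂ (rows-at t) ∷ʳ y
  bump-at {t} {y} t<n y∈ x<y least with step-at t<n
  ... | append all _ _ _ = contradiction x<y (<-asym (All.lookup all y∈))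
  ... | bump {y′} A B all x<y′ e e₁ e₂ _ with ∈-replace⁻ A (subst (y ∈_) e y∈)
  ...   | inj₁ refl       = A , B , e , all , e₁ , e₂
  ...   | inj₂ (inj₁ y∈A) = contradiction x<y (<-asym (All.lookup all y∈A))
  ...   | inj₂ (inj₂ y∈B) = contradiction (least (subst (y′ ∈_) (sym e) (∈-insert A)) x<y′)
    (<⇒≱ (sorted-above A (subst (AllPairs _<_) e (RowInvariant.sorted (invariant bij av t (<⇒≤ t<n)))) y∈B))

  -- Read up to time t, the algorithm still holds the excedance positions es:
  -- those before t are exactly the entries of the first row that can still be bumped.
  record Pending (t : ℕ) (es : List ℕ) : Set where
    field
      increasing : AllPairs _<_ es
      excedance  : ∀ {e} → e ∈ es → ∃ λ p → e ≡ suc p × p < n × suc p < σ ⟨ suc p ⟩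
      upcoming   : ∀ {p} → t ≤ p → p < n → suc p < σ ⟨ suc p ⟩ → suc p ∈ es
      available  : ∀ {p} → suc p ∈ es → p < t → σ ⟨ suc p ⟩ ∈ row₁ (rows-at t)
      bumpable   : ∀ {y a} → y ∈ row₁ (rows-at t) → t ≤ a → a < n → σ ⟨ suc a ⟩ < y →
                   ∃ λ p → suc p ∈ es × p < t × σ ⟨ suc p ⟩ ≡ y

  excedance-at : ∀ {t es p} → Pending t es → suc p ∈ es → p < n × suc p < σ ⟨ suc p ⟩
  excedance-at pend e∈ with Pending.excedance pend e∈
  ... | _ , refl , p<n , exc = p<n , exc

  -- An appended non-excedance lies below everything that follows and is never bumped, so only an
  -- appended excedance becomes bumpable, and that one is still in `es`.
  pending-append : ∀ {t es} → t < n → Pending t es →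
    row₁ (rows-at (suc t)) ≡ row₁ (rows-at t) ∷ʳ σ ⟨ suc t ⟩ → Pending (suc t) es
  pending-append {t} {es} t<n pend e₁ = record
    { increasing = increasing
    ; excedance  = excedance
    ; upcoming   = λ t≤p → upcoming (<⇒≤ t≤p)
    ; available  = λ e∈ p≤t → subst (_ ∈_) (sym e₁) (avail e∈ p≤t)
    ; bumpable   = λ y∈ t<a a<n lt → bumps (∈-∷ʳ⁻ (row₁ (rows-at t)) (subst (_ ∈_) e₁ y∈)) t<a a<n lt
    }
    where
    open Pending pend
    avail : ∀ {p} → suc p ∈ es → p < suc t → σ ⟨ suc p ⟩ ∈ row₁ (rows-at t) ∷ʳ σ ⟨ suc t ⟩
    avail e∈ (s≤s p≤t) with m≤n⇒m<n∨m≡n p≤t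
    ... | inj₁ p<t  = ∈-++⁺ˡ (available e∈ p<t)
    ... | inj₂ refl = ∈-++⁺ʳ (row₁ (rows-at t)) (here refl)
    bumps : ∀ {y a} → y ∈ row₁ (rows-at t) ⊎ y ≡ σ ⟨ suc t ⟩ → t < a → a < n → σ ⟨ suc a ⟩ < y →
      ∃ λ p → suc p ∈ es × p < suc t × σ ⟨ suc p ⟩ ≡ y
    bumps (inj₁ y∈) t<a a<n lt with bumpable y∈ (<⇒≤ t<a) a<n lt
    ... | p , e∈ , p<t , eq = p , e∈ , m<n⇒m<1+n p<t , eq
    bumps (inj₂ refl) t<a a<n lt with σ ⟨ suc t ⟩ ≤? suc t
    ... | yes non = contradiction lt (<-asym (nonExcedance-below bij av t<a a<n non))
    ... | no exc  = t , upcoming ≤-refl t<n (≰⇒> exc) , n<1+n t , refl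

  excedance-step : ∀ {t es} → t < n → Pending t es → suc t < σ ⟨ suc t ⟩ →
    Pending (suc t) es × row₂ (rows-at (suc t)) ≡ row₂ (rows-at t)
  excedance-step {t} t<n pend exc = pending-append t<n pend (proj₁ eqs) , proj₂ eqs
    where
    none : ∀ {y} → y ∈ row₁ (rows-at t) → ¬ (σ ⟨ suc t ⟩ < y)
    none y∈ lt with row₁-position (<⇒≤ t<n) y∈
    ... | p , p<t , refl = <-asym lt (excedance-is-record bij av p<t t<n exc)
    eqs = append-at t<n none

  -- Every bumpable entry comes from a held excedance before time `t`. If all held ones lie ahead,
  -- nothing can be bumped and the entry is appended, just as the algorithm advances `q`.
  skip-nonExcedance : ∀ {t es} → t < n → Pending t es → All (suc t <_) es →
    Pending (suc t) es × row₂ (rows-at (suc t)) ≡ row₂ (rows-at t)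
  skip-nonExcedance {t} t<n pend later = pending-append t<n pend (proj₁ eqs) , proj₂ eqs
    where
    none : ∀ {y} → y ∈ row₁ (rows-at t) → ¬ (σ ⟨ suc t ⟩ < y)
    none y∈ lt with Pending.bumpable pend y∈ ≤-refl t<n lt
    ... | p , e∈ , p<t , _ = <-asym (s≤s p<t) (All.lookup later e∈)
    eqs = append-at t<n none

  -- The current non-excedance is a lower bound for all later entries. An excedance value below it
  -- can therefore never be bumped, and the algorithm may forget it; the tableau does not change.
  skip-excedance : ∀ {t p es} → σ ⟨ suc t ⟩ ≤ suc t → p < t →
    σ ⟨ suc p ⟩ < σ ⟨ suc t ⟩ → Pending t (suc p ∷ es) → Pending t es
  skip-excedance {t} {p} {es} non p<t small pend = record
    { increasing = tail increasing
    ; excedance  = excedance ∘ there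
    ; upcoming   = λ t≤q q<n exc → later t≤q (upcoming t≤q q<n exc)
    ; available  = available ∘ there
    ; bumpable   = λ y∈ t≤a a<n lt → bumps t≤a a<n lt (bumpable y∈ t≤a a<n lt)
    }
    where
    open Pending pend
    tail : ∀ {x xs} → AllPairs _<_ (x ∷ xs) → AllPairs _<_ xs
    tail (_ ∷ s) = s
    later : ∀ {q} → t ≤ q → suc q ∈ suc p ∷ es → suc q ∈ es
    later t≤q (here refl) = contradiction t≤q (<⇒≱ p<t)
    later t≤q (there e∈)  = e∈
    ≤-later : ∀ {a} → t ≤ a → a < n → σ ⟨ suc t ⟩ ≤ σ ⟨ suc a ⟩
    ≤-later t≤a a<n with m≤n⇒m<n∨m≡n t≤a
    ... | inj₁ t<a  = <⇒≤ (nonExcedance-below bij av t<a a<n non)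
    ... | inj₂ refl = ≤-refl
    bumps : ∀ {y a} → t ≤ a → a < n → σ ⟨ suc a ⟩ < y → (∃ λ q → suc q ∈ suc p ∷ es × q < t × σ ⟨ suc q ⟩ ≡ y) →
      ∃ λ q → suc q ∈ es × q < t × σ ⟨ suc q ⟩ ≡ y
    bumps t≤a a<n lt (q , there e∈ , rest)     = q , e∈ , rest
    bumps t≤a a<n lt (q , here refl , _ , refl) = contradiction (<-≤-trans small (≤-later t≤a a<n)) (<-asym lt)

  -- Excedance values increase with position, so the first held excedance carries the least bumpable
  -- value. This is the one that row insertion removes.
  match-step : ∀ {t p es} → t < n → σ ⟨ suc t ⟩ ≤ suc t → p < t →
    σ ⟨ suc t ⟩ ≤ σ ⟨ suc p ⟩ → Pending t (suc p ∷ es) →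
    Pending (suc t) es × row₂ (rows-at (suc t)) ≡ row₂ (rows-at t) ∷ʳ σ ⟨ suc p ⟩
  match-step {t} {p} {es} t<n non p<t large pend with Pending.increasing pend
  ... | above ∷ inc = next , proj₂ (proj₂ (proj₂ (proj₂ (proj₂ bumped))))
    where
    open Pending pend
    x = σ ⟨ suc t ⟩
    x<y : x < σ ⟨ suc p ⟩
    x<y = ≤∧≢⇒< large (λ eq → <⇒≢ p<t (injective (<-trans p<t t<n) t<n (sym eq)))
    least : ∀ {z} → z ∈ row₁ (rows-at t) → x < z → σ ⟨ suc p ⟩ ≤ z
    least z∈ lt with bumpable z∈ ≤-refl t<n lt
    ... | q , here refl , _ , refl = ≤-refl
    ... | q , there e∈ , _ , refl with All.lookup above e∈ | excedance-at pend (there e∈)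
    ...   | s≤s p<q | q<n , exc = <⇒≤ (excedance-is-record bij av p<q q<n exc)
    bumped = bump-at t<n (available (here refl) p<t) x<y least
    A = proj₁ bumped
    B = proj₁ (proj₂ bumped)
    e : row₁ (rows-at t) ≡ A ++ σ ⟨ suc p ⟩ ∷ B
    e = proj₁ (proj₂ (proj₂ bumped))
    all : All (_< x) A
    all = proj₁ (proj₂ (proj₂ (proj₂ bumped)))
    e₁ : row₁ (rows-at (suc t)) ≡ A ++ x ∷ B
    e₁ = proj₁ (proj₂ (proj₂ (proj₂ (proj₂ bumped))))
    kept : ∀ {z} → z ∈ A ⊎ z ∈ B → ∀ {w} → z ∈ A ++ w ∷ B
    kept (inj₁ z∈) = ∈-++⁺ˡ z∈
    kept (inj₂ z∈) = ∈-++⁺ʳ A (there z∈)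
    avail : ∀ {q} → suc q ∈ es → q < suc t → σ ⟨ suc q ⟩ ∈ A ++ x ∷ B
    avail {q} e∈ (s≤s q≤t) with m≤n⇒m<n∨m≡n q≤t
    ... | inj₂ refl = contradiction non (<⇒≱ (proj₂ (excedance-at pend (there e∈))))
    ... | inj₁ q<t with ∈-replace⁻ A (subst (_ ∈_) e (available (there e∈) q<t))
    ...   | inj₂ old = kept old
    ...   | inj₁ eq  = contradiction (All.lookup above e∈) (<-irrefl (cong suc (injective (<-trans p<t t<n) (<-trans q<t t<n) (sym eq))))
    bumps : ∀ {y a} → y ≡ x ⊎ (y ∈ A ⊎ y ∈ B) → t < a → a < n → σ ⟨ suc a ⟩ < y →
      ∃ λ q → suc q ∈ es × q < suc t × σ ⟨ suc q ⟩ ≡ y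
    bumps (inj₁ refl) t<a a<n lt = contradiction lt (<-asym (nonExcedance-below bij av t<a a<n non))
    bumps (inj₂ old) t<a a<n lt with bumpable (subst (_ ∈_) (sym e) (kept old)) (<⇒≤ t<a) a<n lt
    bumps (inj₂ old) t<a a<n lt | q , there e∈ , q<t , eq = q , e∈ , m<n⇒m<1+n q<t , eq
    bumps (inj₂ (inj₁ y∈)) t<a a<n lt | q , here refl , q<t , refl = contradiction x<y (<-asym (All.lookup all y∈))
    bumps (inj₂ (inj₂ y∈)) t<a a<n lt | q , here refl , q<t , refl = contradiction refl
      (<⇒≢ (sorted-above A (subst (AllPairs _<_) e (RowInvariant.sorted (invariant bij av t (<⇒≤ t<n)))) y∈))
    next : Pending (suc t) es
    next = record
      { increasing = inc
      ; excedance  = excedance ∘ there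
      ; upcoming   = λ t<q q<n exc → later t<q (upcoming (<⇒≤ t<q) q<n exc)
      ; available  = λ e∈ q≤t → subst (_ ∈_) (sym e₁) (avail e∈ q≤t)
      ; bumpable   = λ y∈ t<a a<n lt → bumps (∈-replace⁻ A (subst (_ ∈_) e₁ y∈)) t<a a<n lt
      }
      where
      later : ∀ {q} → t < q → suc q ∈ suc p ∷ es → suc q ∈ es
      later t<q (here refl) = contradiction p<t (<-asym t<q)
      later t<q (there e∈)  = e∈

  -- The loop may drop several excedances while the same non-excedance stays at its head. Hence the
  -- recursion here is on `es`, and the run from `suc t` on is passed in as the continuation `rest`.
  nonExcedance-step : ∀ {t} as → t < n → σ ⟨ suc t ⟩ ≤ suc t →
    (∀ es → Pending (suc t) es → row₂ (rows-at n) ≡ row₂ (rows-at (suc t)) ++ map proj₁ (matchLoop σ es as)) →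
    ∀ es → Pending t es → row₂ (rows-at n) ≡ row₂ (rows-at t) ++ map proj₁ (matchLoop σ es (suc t ∷ as))
  nonExcedance-step as t<n non rest [] pend with skip-nonExcedance t<n pend []
  ... | pend′ , eq = trans (rest [] pend′) (cong (_++ []) eq)
  nonExcedance-step {t} as t<n non rest (e ∷ es) pend with Pending.excedance pend (here refl)
  ... | p , refl , p<n , exc with <-cmp t p
  ...   | tri≈ _ refl _ = contradiction non (<⇒≱ exc)
  ...   | tri< t<p _ _ rewrite <ᵇ-true t<p
    with Pending.increasing pend
  ...     | above ∷ _ with skip-nonExcedance t<n pend (s≤s t<p ∷ All.map (<-trans (s≤s t<p)) above)
  ...       | pend′ , eq = trans (rest _ pend′) (cong (_++ map proj₁ (matchLoop σ (suc p ∷ es) as)) eq)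
  nonExcedance-step {t} as t<n non rest (e ∷ es) pend | p , refl , p<n , exc | tri> _ _ p<t
    rewrite <ᵇ-false (<⇒≤ p<t) with σ ⟨ suc p ⟩ <? σ ⟨ suc t ⟩
  ... | yes small rewrite <ᵇ-true small = nonExcedance-step as t<n non rest es (skip-excedance non p<t small pend)
  ... | no ¬small rewrite <ᵇ-false (≮⇒≥ ¬small) with match-step t<n non p<t (≮⇒≥ ¬small) pend
  ...   | pend′ , eq = trans (rest es pend′) (trans (cong (_++ map proj₁ (matchLoop σ es as)) eq)
    (++-assoc (row₂ (rows-at t)) [ σ ⟨ suc p ⟩ ] _))

  matching-from : ∀ k {t} → t + k ≡ n → ∀ es → Pending t es →
    row₂ (rows-at n) ≡ row₂ (rows-at t) ++ map proj₁ (matchLoop σ es (filter nonExc? (range t k)))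
  matching-from zero {t} t+0 es pend rewrite trans (sym (+-identityʳ t)) t+0 =
    sym (trans (cong (λ l → row₂ (rows-at n) ++ map proj₁ l) (matchLoop-[] es)) (++-identityʳ _))
    where
    matchLoop-[] : ∀ es → matchLoop σ es [] ≡ []
    matchLoop-[] []      = refl
    matchLoop-[] (_ ∷ _) = refl
  matching-from (suc k) {t} eq es pend with σ ⟨ suc t ⟩ ≤? suc t
  ... | yes non rewrite filter-accept nonExc? {suc t} {range (suc t) k} non =
    nonExcedance-step _ t<n non (matching-from k (trans (sym (+-suc t k)) eq)) es pend
    where
    t<n : t < n
    t<n = subst (t <_) eq (m<m+n t (s≤s z≤n))
  ... | no exc rewrite filter-reject nonExc? {suc t} {range (suc t) k} exc =
    let pend′ , e₂ = excedance-step t<n pend (≰⇒> exc) in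
    trans (matching-from k (trans (sym (+-suc t k)) eq) es pend′)
      (cong (_++ map proj₁ (matchLoop σ es (filter nonExc? (range (suc t) k)))) e₂)
    where
    t<n : t < n
    t<n = subst (t <_) eq (m<m+n t (s≤s z≤n))

  matchedExcValues-row₂ : row₂ (rows-at n) ≡ matchedExcValues σ
  matchedExcValues-row₂ = trans (matching-from n refl (excedances σ) start)
    (cong (λ as → map proj₁ (matchLoop σ (excedances σ) (filter nonExc? as)))
      (trans (sym (applyUpTo-range suc 0 n (λ _ → refl))) (cong [1…_] (sym len))))
    where
    exc? = λ i → i <? σ ⟨ i ⟩
    start : Pending 0 (excedances σ)
    start = record
      { increasing = AllPairsₚ.filter⁺ exc? (AllPairsₚ.applyUpTo⁺₁ suc (length σ) (λ i<j _ → s≤s i<j))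
      ; excedance  = exc
      ; upcoming   = λ _ p<n e → ∈-filter⁺ exc? (∈-[1…] (s≤s z≤n) (≤-trans p<n (≤-reflexive (sym len)))) e
      ; available  = λ _ ()
      ; bumpable   = λ ()
      }
      where
      exc : ∀ {e} → e ∈ excedances σ → ∃ λ p → e ≡ suc p × p < n × suc p < σ ⟨ suc p ⟩
      exc e∈ with ∈-filter⁻ exc? {xs = [1… length σ ]} e∈
      ... | e∈′ , e< with ∈-applyUpTo⁻ suc e∈′
      ...   | p , p< , refl = p , refl , subst (p <_) len p< , e<

-- Appending an entry inserts a peak into the path

module _ (f : ℕ → ℕ) (f-<ᵇ : ∀ x y → (f x <ᵇ f y) ≡ (x <ᵇ y)) where

  rowIns-map : ∀ x r → rowIns (f x) (map f r) ≡ (Maybe.map f (proj₁ (rowIns x r)) , map f (proj₂ (rowIns x r)))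
  rowIns-map x []       = refl
  rowIns-map x (y ∷ ys) rewrite f-<ᵇ x y with x <ᵇ y
  ... | true  = refl
  ... | false rewrite rowIns-map x ys = refl

  tabIns-map : ∀ x P → tabIns (f x) (map (map f) P) ≡ (map (map f) (proj₁ (tabIns x P)) , proj₂ (tabIns x P))
  tabIns-map x []       = refl
  tabIns-map x (r ∷ rs) rewrite rowIns-map x r with rowIns x r
  ... | nothing , _ = refl
  ... | just y  , _ rewrite tabIns-map y rs = refl

  relabel : State → State
  relabel (P , Q , i) = map (map f) P , Q , i

  -- Insertion only compares entries, so an order-preserving relabelling changes the entries of P
  -- and leaves Q alone. With `lift v` this identifies the state of `σ` before its last insertion
  -- with the relabelled final state of `π`.
  foldl-rsStep-map : ∀ s xs → foldl rsStep (relabel s) (map f xs) ≡ relabel (foldl rsStep s xs)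
  foldl-rsStep-map s []       = refl
  foldl-rsStep-map s@(P , Q , i) (x ∷ xs) rewrite tabIns-map x P = foldl-rsStep-map (rsStep s x) xs

  row₁-relabel : ∀ s → row₁ (relabel s) ≡ map f (row₁ s)
  row₁-relabel ([]    , _) = refl
  row₁-relabel (_ ∷ _ , _) = refl

insertPeak : ℕ → List Bool → List Bool
insertPeak p D = take p D ++ true ∷ false ∷ drop p D

insertPeak-++ : ∀ p D {E} → p ≤ length D → insertPeak p (D ++ E) ≡ insertPeak p D ++ E
insertPeak-++ zero    D       _       = refl
insertPeak-++ (suc p) (x ∷ D) (s≤s l) = cong (x ∷_) (insertPeak-++ p D l)

applyUpTo-insertPeak : ∀ (f g : ℕ → Bool) {k n} → k ≤ n →
  (∀ i → i < k → f i ≡ g i) → f k ≡ true → f (suc k) ≡ false → (∀ i → k ≤ i → i < n → f (suc (suc i)) ≡ g i) →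
  applyUpTo f (suc (suc n)) ≡ insertPeak k (applyUpTo g n)
applyUpTo-insertPeak f g {zero}  {n}     _       _  up down after =
  cong₂ _∷_ up (cong₂ _∷_ down (applyUpTo-cong n (λ i → after i z≤n)))
applyUpTo-insertPeak f g {suc k} {suc n} (s≤s p) lt up down after = cong₂ _∷_ (lt 0 (s≤s z≤n))
  (applyUpTo-insertPeak (f ∘ suc) (g ∘ suc) p (λ i i< → lt (suc i) (s≤s i<)) up down (λ i k≤ i< → after (suc i) (s≤s k≤) (s≤s i<)))

elemᵇ-cong : ∀ {x y} xs ys → (x ∈ xs → y ∈ ys) → (y ∈ ys → x ∈ xs) → elemᵇ x xs ≡ elemᵇ y ys
elemᵇ-cong {x} {y} xs ys to from with elemᵇ x xs in eq
... | true  = sym (∈⇒elemᵇ (to (elemᵇ⇒∈ xs eq)))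
... | false = sym (∉⇒elemᵇ ys λ y∈ → contradiction (trans (sym (∈⇒elemᵇ (from y∈))) eq) λ ())

leftWord rightWord : State → ℕ → List Bool
leftWord s n  = applyUpTo (λ i → elemᵇ (suc i) (row₁ s)) n
rightWord s n = map (λ j → elemᵇ j (times₂ s)) (reverse [1… n ])

finalState : List ℕ → State
finalState σ = foldl rsStep ([] , [] , 0) σ

Ψ-words : ∀ σ → Ψ σ ≡ leftWord (finalState σ) (length σ) ++ rightWord (finalState σ) (length σ)
Ψ-words σ = cong (_++ rightWord (finalState σ) (length σ))
  (map-applyUpTo suc (λ i → elemᵇ i (row₁ (finalState σ))) (length σ))

reverse-[1…suc] : ∀ n → reverse [1… suc n ] ≡ suc n ∷ reverse [1… n ]
reverse-[1…suc] n = trans (cong reverse (sym (applyUpTo-∷ʳ suc n))) (reverse-++ [1… n ] [ suc n ])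

module _ {N π} (bij : IsBijection N π) where
  open IsBijection bij using (len)

  append-⟨⟩ : ∀ {v p} → p < N → (map (lift v) π ∷ʳ v) ⟨ suc p ⟩ ≡ lift v (π ⟨ suc p ⟩)
  append-⟨⟩ {v} p<N = trans (⟨⟩-++ˡ (map (lift v) π) [ v ] (≤-trans p<N (≤-reflexive (sym (trans (length-map _ π) len)))))
    (⟨⟩-map (lift v) π (≤-trans p<N (≤-reflexive (sym len))))

  append-last : ∀ {v} → (map (lift v) π ∷ʳ v) ⟨ suc N ⟩ ≡ v
  append-last {v} = subst (λ l → (map (lift v) π ∷ʳ v) ⟨ suc l ⟩ ≡ v) (trans (length-map _ π) len) (⟨⟩-++-mid (map (lift v) π))

module _ {N π} (bij : IsBijection N π) (av : No321 N π) where
  open IsBijection bij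

  final-invariant : RowInvariant π N (finalState π)
  final-invariant = subst (λ ρ → RowInvariant π N (foldl rsStep ([] , [] , 0) ρ))
    (take-all N π (≤-reflexive len)) (invariant bij av N ≤-refl)

  final-entries : row₁ (finalState π) ++ row₂ (finalState π) ↭ π
  final-entries = subst (_ ↭_) (take-all N π (≤-reflexive len)) (RowInvariant.entries final-invariant)

  final-disjoint : ∀ {c} → c ∈ row₁ (finalState π) → c ∉ row₂ (finalState π)
  final-disjoint = Unique-++-disjoint (row₁ (finalState π)) (Unique-↭ (↭-sym final-entries) unique)

  final-split : ∀ {p} → p < N → π ⟨ suc p ⟩ ∈ row₁ (finalState π) ⊎ π ⟨ suc p ⟩ ∈ row₂ (finalState π)
  final-split p<N = ∈-++⁻ (row₁ (finalState π))
    (∈-resp-↭ (↭-sym final-entries) (⟨⟩-∈ π (≤-trans p<N (≤-reflexive (sym len)))))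

  final-cover : ∀ {c} → 1 ≤ c → c ≤ N → c ∈ row₁ (finalState π) ⊎ c ∈ row₂ (finalState π)
  final-cover 1≤c c≤N with surjective 1≤c c≤N
  ... | p , p<N , refl = final-split p<N

  row₁-bound : ∀ {c} → c ∈ row₁ (finalState π) → c ≤ N
  row₁-bound c∈ with ∈-⟨⟩ (∈-resp-↭ final-entries (∈-++⁺ˡ c∈))
  ... | p , p< , refl = bounded (subst (p <_) len p<)

  -- In the word, the letters of the left half from v on have the form d … d u … u.
  TailSorted : ℕ → Set
  TailSorted v = ∀ {i j} → v ≤ i → i < j → j ≤ N → i ∈ row₁ (finalState π) → j ∈ row₁ (finalState π)

  -- If `i` is in the first row and `j > i` in the second, separation gives a descent in `π` from
  -- `j` to an entry at least `i`. Both of its entries are at least `v`, so the appended `v`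
  -- completes a 321.
  No321⇒TailSorted : ∀ {v} → 1 ≤ v → No321 (suc N) (map (lift v) π ∷ʳ v) → TailSorted v
  No321⇒TailSorted {v} 1≤v avσ {i} {j} v≤i i<j j≤N i∈ with final-cover (≤-trans 1≤v (≤-trans v≤i (<⇒≤ i<j))) j≤N
  ... | inj₁ j∈ = j∈
  ... | inj₂ j∈ with RowInvariant.separation final-invariant j∈ i∈ i<j
  ...   | p , q , p<q , q<N , refl , i≤ , <j = ⊥-elim (avσ p<q q<N (n<1+n N)
    (subst₂ _<_ (sym (append-last bij)) (sym (append-⟨⟩ bij q<N)) (subst (v <_) (sym (lift-≥ (≤-trans v≤i i≤))) (s≤s (≤-trans v≤i i≤))))
    (subst₂ _<_ (sym (append-⟨⟩ bij q<N)) (sym (append-⟨⟩ bij (<-trans p<q q<N))) (lift-mono v <j)))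

  -- A new 321 must end in `v`, so its middle entry is at least `v` in `π`, and `inversion` puts
  -- some `z` above that entry in the second row. If the middle entry is in the first row,
  -- sortedness puts `z` there too. If it is in the second row, `displaced` finds a later smaller
  -- entry, and `π` already contains a 321.
  TailSorted⇒No321 : ∀ {v} → TailSorted v → No321 (suc N) (map (lift v) π ∷ʳ v)
  TailSorted⇒No321 {v} sorted {i} {j} {k} i<j j<k (s≤s k≤N) kj ji
    with lift-mono⁻ v (subst₂ _<_ (append-⟨⟩ bij (<-≤-trans j<k k≤N)) (append-⟨⟩ bij (<-trans i<j (<-≤-trans j<k k≤N))) ji) | m≤n⇒m<n∨m≡n k≤N
  ... | ji′ | inj₁ k<N = av i<j j<k k<N (lift-mono⁻ v (subst₂ _<_ (append-⟨⟩ bij k<N) (append-⟨⟩ bij (<-trans j<k k<N)) kj)) ji′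
  ... | ji′ | inj₂ refl with <-lift (subst₂ _<_ (append-last bij) (append-⟨⟩ bij j<k) kj) | RowInvariant.inversion final-invariant i<j j<k ji′
  ...   | v≤ | z , z∈ , <z with final-split j<k
  ...     | inj₁ j∈ = final-disjoint (sorted v≤ <z z≤N j∈) z∈
    where
    z≤N : z ≤ N
    z≤N with ∈-⟨⟩ (∈-resp-↭ final-entries (∈-++⁺ʳ (row₁ (finalState π)) z∈))
    ... | p , p< , refl = bounded (subst (p <_) len p<)
  ...     | inj₂ j∈ with RowInvariant.displaced final-invariant j∈
  ...       | p , q , p<q , q<N , eq , <πj with injective (<-trans p<q q<N) j<k eq
  ...         | refl = av i<j p<q q<N <πj ji′

  module _ {k} (k≤N : k ≤ N) (sorted : TailSorted (suc k))
           (bijσ : IsBijection (suc N) (map (lift (suc k)) π ∷ʳ suc k)) (avσ : No321 (suc N) (map (lift (suc k)) π ∷ʳ suc k)) where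

    private
      v = suc k
      f = lift v
      σ = map f π ∷ʳ v
      s = finalState π
      s′ = finalState σ

      before : State
      before = relabel f (lift-<ᵇ v) s

      last-step : Step before v s′
      last-step = subst₂ (λ a b → Step a v b) before-eq after-eq
        (subst (λ y → Step (state σ N) y (state σ (suc N))) (append-last bij) (step-at bijσ avσ (n<1+n N)))
        where
        take-N : take N σ ≡ map f π
        take-N = subst (λ m → take m σ ≡ map f π) (trans (length-map f π) len) (take-length-++ (map f π))
          where
          take-length-++ : ∀ (xs : List ℕ) {ys} → take (length xs) (xs ++ ys) ≡ xs
          take-length-++ []       = refl
          take-length-++ (x ∷ xs) = cong (x ∷_) (take-length-++ xs)
        before-eq : state σ N ≡ before
        before-eq = trans (cong finalState take-N) (foldl-rsStep-map f (lift-<ᵇ v) ([] , [] , 0) π)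
        after-eq : state σ (suc N) ≡ s′
        after-eq = cong finalState (take-all (suc N) σ (≤-reflexive (IsBijection.len bijσ)))

      lifted : ∀ {c} → c ∈ row₁ before → ∃ λ d → d ∈ row₁ s × c ≡ f d
      lifted c∈ = ∈-map⁻ f (subst (_ ∈_) (row₁-relabel f (lift-<ᵇ v) s) c∈)

      lift∈ : ∀ {d} → d ∈ row₁ s → f d ∈ row₁ before
      lift∈ d∈ = subst (_ ∈_) (sym (row₁-relabel f (lift-<ᵇ v) s)) (∈-map⁺ f d∈)

      Smaller : ℕ → Set
      Smaller c = ∃ λ d → d ∈ row₁ s × v ≤ d × d < c

      -- Above v, an entry c + 1 survives in the first row iff some entry of [v, c) was there before,
      -- namely the bumped one; by TailSorted this means that c - 1 was there, whence the shift by two letters.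
      record Inserted : Set where
        field
          below⁺ : ∀ {c} → c < v → c ∈ row₁ s → c ∈ row₁ s′
          below⁻ : ∀ {c} → c < v → c ∈ row₁ s′ → c ∈ row₁ s
          at     : v ∈ row₁ s′
          above⁺ : ∀ {c} → c ≤ N → Smaller c → suc c ∈ row₁ s′
          above⁻ : ∀ {c} → v ≤ c → suc c ∈ row₁ s′ → Smaller c
          time⁺  : Smaller (suc N) → suc N ∈ times₂ s′
          time⁻  : suc N ∈ times₂ s′ → Smaller (suc N)
          times⁺ : ∀ {j} → j ≤ N → j ∈ times₂ s → j ∈ times₂ s′
          times⁻ : ∀ {j} → j ≤ N → j ∈ times₂ s′ → j ∈ times₂ s

      -- If `v` is appended, the first row has no entry from `v` on and `Smaller` never holds. If
      -- `v` bumps `y`, then `y` is the lift of the least such entry `y₀`, and `Smaller c` amounts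
      -- to `y₀ < c`.
      inserted : Step before v s′ → Inserted
      inserted (append all e₁ e₂ eq) = record
        { below⁺ = λ c<v c∈ → subst (_ ∈_) (sym e₁) (∈-++⁺ˡ (subst (_∈ row₁ before) (lift-< c<v) (lift∈ c∈)))
        ; below⁻ = λ c<v c∈ → below⁻ c<v (∈-∷ʳ⁻ (row₁ before) (subst (_ ∈_) e₁ c∈))
        ; at     = subst (_ ∈_) (sym e₁) (∈-++⁺ʳ (row₁ before) (here refl))
        ; above⁺ = λ _ sm → ⊥-elim (none sm)
        ; above⁻ = λ v≤c c∈ → ⊥-elim (none′ v≤c (∈-∷ʳ⁻ (row₁ before) (subst (_ ∈_) e₁ c∈)))
        ; time⁺  = λ sm → ⊥-elim (none sm)
        ; time⁻  = λ t∈ → contradiction (All.lookup (RowInvariant.times-≤ final-invariant) (subst (_ ∈_) eq t∈)) (<⇒≱ (n<1+n N))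
        ; times⁺ = λ _ → subst (_ ∈_) (sym eq)
        ; times⁻ = λ _ → subst (_ ∈_) eq
        }
        where
        none : ∀ {c} → Smaller c → ⊥
        none (d , d∈ , v≤d , _) = <-asym (All.lookup all (lift∈ d∈)) (subst (v <_) (sym (lift-≥ v≤d)) (s≤s v≤d))
        none′ : ∀ {c} → v ≤ c → suc c ∈ row₁ before ⊎ suc c ≡ v → ⊥
        none′ v≤c (inj₁ c∈)   = <-asym (All.lookup all c∈) (s≤s v≤c)
        none′ v≤c (inj₂ refl) = <-irrefl refl v≤c
        below⁻ : ∀ {c} → c < v → c ∈ row₁ before ⊎ c ≡ v → c ∈ row₁ s
        below⁻ c<v (inj₂ refl) = contradiction c<v (<-irrefl refl)
        below⁻ c<v (inj₁ c∈) with lifted c∈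
        ... | d , d∈ , eq = subst (_∈ row₁ s) (lift-injective v (trans (sym eq) (sym (lift-< c<v)))) d∈
      inserted (bump {y} A B all v<y e e₁ e₂ eq) = record
        { below⁺ = λ c<v c∈ → subst (_ ∈_) (sym e₁) (kept (<⇒≢ (<-trans c<v v<y)) (subst (_∈ row₁ before) (lift-< c<v) (lift∈ c∈)))
        ; below⁻ = λ c<v c∈ → below⁻ c<v (old (subst (_ ∈_) e₁ c∈))
        ; at     = subst (_ ∈_) (sym e₁) (∈-insert A)
        ; above⁺ = λ c≤N sm → subst (_ ∈_) (sym e₁) (above⁺ c≤N sm)
        ; above⁻ = λ v≤c c∈ → above⁻ v≤c (old (subst (_ ∈_) e₁ c∈))
        ; time⁺  = λ _ → subst (_ ∈_) (sym eq) (∈-++⁺ʳ (times₂ s) (here (cong suc (sym (RowInvariant.synced final-invariant)))))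
        ; time⁻  = λ _ → y₀ , y₀∈ , v≤y₀ , s≤s (row₁-bound y₀∈)
        ; times⁺ = λ _ j∈ → subst (_ ∈_) (sym eq) (∈-++⁺ˡ j∈)
        ; times⁻ = λ j≤N j∈ → times⁻ j≤N (∈-∷ʳ⁻ (times₂ s) (subst (_ ∈_) eq j∈))
        }
        where
        before-unique : AllPairs _<_ (A ++ y ∷ B)
        before-unique = subst (AllPairs _<_) (trans (sym (row₁-relabel f (lift-<ᵇ v) s)) e)
          (AllPairsₚ.map⁺ (AllPairs.map (lift-mono v) (RowInvariant.sorted final-invariant)))
        preimage : ∃ λ d → d ∈ row₁ s × y ≡ f d
        preimage = lifted (subst (y ∈_) (sym e) (∈-insert A))
        y₀ = proj₁ preimage
        y₀∈ : y₀ ∈ row₁ s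
        y₀∈ = proj₁ (proj₂ preimage)
        y≡ : y ≡ f y₀
        y≡ = proj₂ (proj₂ preimage)
        v≤y₀ : v ≤ y₀
        v≤y₀ = <-lift (subst (v <_) y≡ v<y)
        kept : ∀ {c} → c ≢ y → c ∈ row₁ before → c ∈ A ++ v ∷ B
        kept ne c∈ with ∈-replace⁻ A (subst (_ ∈_) e c∈)
        ... | inj₁ eq′        = contradiction eq′ ne
        ... | inj₂ (inj₁ c∈A) = ∈-++⁺ˡ c∈A
        ... | inj₂ (inj₂ c∈B) = ∈-++⁺ʳ A (there c∈B)
        old : ∀ {c} → c ∈ A ++ v ∷ B → c ≡ v ⊎ (c ∈ row₁ before × (c < v ⊎ y < c))
        old c∈ with ∈-replace⁻ A c∈
        ... | inj₁ eq′        = inj₁ eq′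
        ... | inj₂ (inj₁ c∈A) = inj₂ (subst (_ ∈_) (sym e) (∈-++⁺ˡ c∈A) , inj₁ (All.lookup all c∈A))
        ... | inj₂ (inj₂ c∈B) = inj₂ (subst (_ ∈_) (sym e) (∈-++⁺ʳ A (there c∈B)) , inj₂ (sorted-above A before-unique c∈B))
        below⁻ : ∀ {c} → c < v → c ≡ v ⊎ (c ∈ row₁ before × (c < v ⊎ y < c)) → c ∈ row₁ s
        below⁻ c<v (inj₁ refl) = contradiction c<v (<-irrefl refl)
        below⁻ c<v (inj₂ (c∈ , _)) with lifted c∈
        ... | d , d∈ , eq′ = subst (_∈ row₁ s) (lift-injective v (trans (sym eq′) (sym (lift-< c<v)))) d∈
        above⁻ : ∀ {c} → v ≤ c → suc c ≡ v ⊎ (suc c ∈ row₁ before × (suc c < v ⊎ y < suc c)) → Smaller c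
        above⁻ v≤c (inj₁ refl)            = contradiction v≤c (<-irrefl refl)
        above⁻ v≤c (inj₂ (_ , inj₁ c<v))  = contradiction (<-trans (n<1+n _) c<v) (≤⇒≯ v≤c)
        above⁻ v≤c (inj₂ (_ , inj₂ y<c))  = y₀ , y₀∈ , v≤y₀ , ≤-pred (subst (_< suc _) (trans y≡ (lift-≥ v≤y₀)) y<c)
        least : ∀ {d} → d ∈ row₁ s → v ≤ d → y₀ ≤ d
        least {d} d∈ v≤d with ∈-replace⁻ A (subst (f d ∈_) e (lift∈ d∈))
        ... | inj₁ eq′        = ≤-reflexive (lift-injective v (trans (sym y≡) (sym eq′)))
        ... | inj₂ (inj₁ d∈A) = contradiction (All.lookup all d∈A) (<-asym (subst (v <_) (sym (lift-≥ v≤d)) (s≤s v≤d)))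
        ... | inj₂ (inj₂ d∈B) = <⇒≤ (lift-mono⁻ v (subst (_< f d) y≡ (sorted-above A before-unique d∈B)))
        above⁺ : ∀ {c} → c ≤ N → Smaller c → suc c ∈ A ++ v ∷ B
        above⁺ {c} c≤N (d , d∈ , v≤d , d<c) = kept
          (λ eq′ → <⇒≢ (≤-<-trans (least d∈ v≤d) d<c) (lift-injective v (trans (sym y≡) (trans (sym eq′) (sym f-c)))))
          (subst (_∈ row₁ before) f-c (lift∈ (sorted v≤d d<c c≤N d∈)))
          where
          f-c : f c ≡ suc c
          f-c = lift-≥ (≤-trans v≤d (<⇒≤ d<c))
        times⁻ : ∀ {j} → j ≤ N → j ∈ times₂ s ⊎ j ≡ suc (clock before) → j ∈ times₂ s
        times⁻ _   (inj₁ j∈)   = j∈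
        times⁻ j≤N (inj₂ refl) = contradiction j≤N (<⇒≱ (s≤s (≤-reflexive (sym (RowInvariant.synced final-invariant)))))

      -- One word of length `N + 2` running across the middle: the left half of the path of `σ`,
      -- then the first letter of the right half.
      letter : ℕ → Bool
      letter i = if i <ᵇ suc N then elemᵇ (suc i) (row₁ s′) else elemᵇ (suc N) (times₂ s′)

      letter-row : ∀ {i} → i ≤ N → letter i ≡ elemᵇ (suc i) (row₁ s′)
      letter-row i≤N rewrite <ᵇ-true (s≤s i≤N) = refl

      letter-time : letter (suc N) ≡ elemᵇ (suc N) (times₂ s′)
      letter-time rewrite <ᵇ-false (≤-refl {suc N}) = refl

      letters : leftWord s′ (suc N) ∷ʳ elemᵇ (suc N) (times₂ s′) ≡ insertPeak k (leftWord s N)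
      letters = trans (cong₂ _∷ʳ_ (applyUpTo-cong (suc N) (λ i i≤ → sym (letter-row (≤-pred i≤)))) (sym letter-time))
        (trans (applyUpTo-∷ʳ letter (suc N)) (applyUpTo-insertPeak letter (λ i → elemᵇ (suc i) (row₁ s)) k≤N first up down rest))
        where
        open Inserted (inserted last-step)
        first : ∀ i → i < k → letter i ≡ elemᵇ (suc i) (row₁ s)
        first i i<k = trans (letter-row (≤-trans (<⇒≤ i<k) k≤N))
          (elemᵇ-cong (row₁ s′) (row₁ s) (below⁻ (s≤s i<k)) (below⁺ (s≤s i<k)))
        up : letter k ≡ true
        up = trans (letter-row k≤N) (∈⇒elemᵇ at)
        empty-range : Smaller (suc k) → ⊥
        empty-range (_ , _ , v≤d , d<v) = <⇒≱ d<v v≤d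
        down : letter (suc k) ≡ false
        -- For `k = N` the peak straddles the middle: its down-step records that time `N + 1` is not
        -- in the second row of Q.
        down with m≤n⇒m<n∨m≡n k≤N
        ... | inj₁ k<N  = trans (letter-row k<N) (∉⇒elemᵇ (row₁ s′) (empty-range ∘ above⁻ ≤-refl))
        ... | inj₂ refl = trans letter-time (∉⇒elemᵇ (times₂ s′) (empty-range ∘ time⁻))
        top : ∀ {i} → suc i ≤ N → Smaller (suc (suc i)) → suc i ∈ row₁ s
        top i<N (d , d∈ , v≤d , s≤s d≤) with m≤n⇒m<n∨m≡n d≤
        ... | inj₁ d<   = sorted v≤d d< i<N d∈
        ... | inj₂ refl = d∈
        rest : ∀ i → k ≤ i → i < N → letter (suc (suc i)) ≡ elemᵇ (suc i) (row₁ s)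
        rest i k≤i i<N with m≤n⇒m<n∨m≡n i<N
        ... | inj₁ i+1<N = trans (letter-row i+1<N) (elemᵇ-cong (row₁ s′) (row₁ s)
          (top i<N ∘ above⁻ (m≤n⇒m≤1+n (s≤s k≤i))) (λ i∈ → above⁺ i+1<N (_ , i∈ , s≤s k≤i , ≤-refl)))
        ... | inj₂ refl  = trans letter-time (elemᵇ-cong (times₂ s′) (row₁ s)
          (top i<N ∘ time⁻) (λ i∈ → time⁺ (_ , i∈ , s≤s k≤i , ≤-refl)))

      rightWord-suc : rightWord s′ (suc N) ≡ elemᵇ (suc N) (times₂ s′) ∷ rightWord s N
      rightWord-suc rewrite reverse-[1…suc] N = cong (elemᵇ (suc N) (times₂ s′) ∷_) (map-cong-local (All.tabulate λ {j} j∈ →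
        let j≤N = proj₂ ([1…]-bounds (∈-resp-↭ (↭-reverse [1… N ]) j∈)) in
        elemᵇ-cong (times₂ s′) (times₂ s) (times⁻ j≤N) (times⁺ j≤N)))
        where open Inserted (inserted last-step)

    Ψ-insert : Ψ (map (lift (suc k)) π ∷ʳ suc k) ≡ insertPeak k (Ψ π)
    Ψ-insert = begin
      Ψ σ                                                ≡⟨ Ψ-words σ ⟩
      leftWord s′ (length σ) ++ rightWord s′ (length σ)  ≡⟨ cong (λ l → leftWord s′ l ++ rightWord s′ l) (IsBijection.len bijσ) ⟩
      leftWord s′ (suc N) ++ rightWord s′ (suc N)        ≡⟨ cong (leftWord s′ (suc N) ++_) rightWord-suc ⟩
      leftWord s′ (suc N) ++ c ∷ rightWord s N           ≡⟨ sym (++-assoc (leftWord s′ (suc N)) [ c ] (rightWord s N)) ⟩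
      (leftWord s′ (suc N) ∷ʳ c) ++ rightWord s N        ≡⟨ cong (_++ rightWord s N) letters ⟩
      insertPeak k (leftWord s N) ++ rightWord s N       ≡⟨ sym (insertPeak-++ k (leftWord s N) (≤-trans k≤N (≤-reflexive (sym (length-applyUpTo _ N))))) ⟩
      insertPeak k (leftWord s N ++ rightWord s N)       ≡⟨ cong (λ l → insertPeak k (leftWord s l ++ rightWord s l)) (sym len) ⟩
      insertPeak k (leftWord s (length π) ++ rightWord s (length π)) ≡⟨ cong (insertPeak k) (sym (Ψ-words π)) ⟩
      insertPeak k (Ψ π)                                 ∎
      where
      open ≡-Reasoning
      c = elemᵇ (suc N) (times₂ s′)

-- Tunnels

ups downs : List Bool → ℕ
ups []            = 0
ups (true ∷ D)    = suc (ups D)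
ups (false ∷ D)   = ups D
downs []          = 0
downs (true ∷ D)  = downs D
downs (false ∷ D) = suc (downs D)

ups+downs : ∀ D → ups D + downs D ≡ length D
ups+downs []          = refl
ups+downs (true ∷ D)  = cong suc (ups+downs D)
ups+downs (false ∷ D) = trans (+-suc (ups D) (downs D)) (cong suc (ups+downs D))

ups-take-mono : ∀ {p q} D → p ≤ q → ups (take p D) ≤ ups (take q D)
ups-take-mono []          z≤n     = z≤n
ups-take-mono []          (s≤s _) = z≤n
ups-take-mono (_ ∷ _)     z≤n     = z≤n
ups-take-mono (true ∷ D)  (s≤s l) = s≤s (ups-take-mono D l)
ups-take-mono (false ∷ D) (s≤s l) = ups-take-mono D l

ups+downs-take : ∀ {p} D → p ≤ length D → ups (take p D) + downs (take p D) ≡ p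
ups+downs-take {p} D p≤ = trans (ups+downs (take p D)) (trans (length-take p D) (m≤n⇒m⊓n≡m p≤))

lift-≢ : ∀ b x → lift b x ≢ b
lift-≢ b x eq with b ≤? x
... | yes p = <⇒≢ (s≤s p) (trans (sym eq) (lift-≥ p))
... | no p  = <⇒≢ (≰⇒> p) (trans (sym (lift-< (≰⇒> p))) eq)

lift-≡ᵇ : ∀ b x y → (lift b x ≡ᵇ lift b y) ≡ (x ≡ᵇ y)
lift-≡ᵇ b x y with x ≟ y
... | yes refl = trans (≡ᵇ-refl (lift b x)) (sym (≡ᵇ-refl x))
... | no ne    = trans (≡ᵇ-false (ne ∘ lift-injective b)) (sym (≡ᵇ-false ne))

assoc-∷-lift : ∀ b b′ x y ℓ T T′ → assoc (lift b ℓ) T′ ≡ lift b′ (assoc ℓ T) →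
  assoc (lift b ℓ) ((lift b x , lift b′ y) ∷ T′) ≡ lift b′ (assoc ℓ ((x , y) ∷ T))
assoc-∷-lift b b′ x y ℓ T T′ eq rewrite lift-≡ᵇ b x ℓ with x ≡ᵇ ℓ
... | true  = refl
... | false = eq

module _ (N : ℕ) where

  -- After the peak both counters are one ahead. Up-labels agree because `suc N ∸ suc u` is `N ∸ u`;
  -- they are below `K` and fixed by the lift. Down-labels are one larger, and the old ones, being
  -- at least `J`, are lifted by one.
  tunnels-after-peak : ∀ {K J} B {u d st} → N ∸ u < K → 0 < J → J ≤ suc d → ∀ ℓ →
    assoc (lift K ℓ) (tunnels (suc N) B (suc u) (suc d) (map (lift K) st)) ≡ lift J (assoc ℓ (tunnels N B u d st))
  tunnels-after-peak [] _ 0<J _ ℓ = sym (lift-< 0<J)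
  tunnels-after-peak {K} {J} (true ∷ B) {u} {d} {st} u< 0<J J≤ ℓ =
    trans (cong (λ x → assoc (lift K ℓ) (tunnels (suc N) B (suc (suc u)) (suc d) (x ∷ map (lift K) st))) (sym (lift-< u<)))
      (tunnels-after-peak B {suc u} {d} {(N ∸ u) ∷ st} (≤-<-trans (∸-monoʳ-≤ N (n≤1+n u)) u<) 0<J J≤ ℓ)
  tunnels-after-peak (false ∷ B) {st = []} u< 0<J J≤ ℓ = tunnels-after-peak B u< 0<J (m≤n⇒m≤1+n J≤) ℓ
  tunnels-after-peak {K} {J} (false ∷ B) {u} {d} {x ∷ st} u< 0<J J≤ ℓ =
    trans (cong (λ y → assoc (lift K ℓ) ((lift K x , y) ∷ tunnels (suc N) B (suc u) (suc (suc d)) (map (lift K) st))) (sym (lift-≥ J≤)))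
      (assoc-∷-lift K J x (suc d) ℓ (tunnels N B u (suc d) st) (tunnels (suc N) B (suc u) (suc (suc d)) (map (lift K) st)) (tunnels-after-peak B {u} {suc d} {st} u< 0<J (m≤n⇒m≤1+n J≤) ℓ))

  -- Before the peak the situation is reversed: up-labels are one larger, as old labels are at least
  -- `K`, while down-labels are below `J` and unchanged. The peak opens label `K` and closes it at
  -- once with `J`. The stack is general so that the induction passes through `A`.
  tunnels-insertPeak : ∀ {K J} A B {u d st} → u + ups A ≤ N → K ≡ suc N ∸ (u + ups A) → J ≡ suc (d + downs A) →
    let T′ = tunnels (suc N) (A ++ true ∷ false ∷ B) u d (map (lift K) st) in
    assoc K T′ ≡ J × (∀ ℓ → assoc (lift K ℓ) T′ ≡ lift J (assoc ℓ (tunnels N (A ++ B) u d st)))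
  tunnels-insertPeak {K} [] B {u} {d} {st} u≤ eqK refl rewrite +-identityʳ u | +-identityʳ d | sym eqK | ≡ᵇ-refl K =
    refl , λ ℓ → trans (cong (λ b → if b then suc d else assoc (lift K ℓ) (tunnels (suc N) B (suc u) (suc d) (map (lift K) st))) (≡ᵇ-false (λ eq → lift-≢ K ℓ (sym eq))))
      (tunnels-after-peak B {u} {d} {st} (subst (N ∸ u <_) (sym (trans eqK (+-∸-assoc 1 u≤))) (n<1+n _)) (s≤s z≤n) ≤-refl ℓ)
  tunnels-insertPeak {K} {J} (true ∷ A) B {u} {d} {st} u≤ eqK eqJ =
    subst (λ x → let T′ = tunnels (suc N) (A ++ true ∷ false ∷ B) (suc u) d (x ∷ map (lift K) st) in
        assoc K T′ ≡ J × (∀ ℓ → assoc (lift K ℓ) T′ ≡ lift J (assoc ℓ (tunnels N (A ++ B) (suc u) d ((N ∸ u) ∷ st)))))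
      (trans (lift-≥ K≤) (sym (+-∸-assoc 1 (m+n≤o⇒m≤o u u≤))))
      (tunnels-insertPeak A B {suc u} {d} {(N ∸ u) ∷ st} (subst (_≤ N) (+-suc u (ups A)) u≤)
        (trans eqK (cong (suc N ∸_) (+-suc u (ups A)))) eqJ)
    where
    K≤ : K ≤ N ∸ u
    K≤ = subst (_≤ N ∸ u) (sym (trans eqK (cong (suc N ∸_) (+-suc u (ups A))))) (∸-monoʳ-≤ N (m≤m+n u (ups A)))
  tunnels-insertPeak (false ∷ A) B {u} {d} {[]} u≤ eqK eqJ = tunnels-insertPeak A B u≤ eqK (trans eqJ (cong suc (+-suc d (downs A))))
  tunnels-insertPeak {K} {J} (false ∷ A) B {u} {d} {x ∷ st} u≤ eqK eqJ
    with tunnels-insertPeak A B {u} {suc d} {st} u≤ eqK (trans eqJ (cong suc (+-suc d (downs A))))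
  ... | at , off rewrite ≡ᵇ-false (lift-≢ K x) = at , λ ℓ →
    trans (cong (λ y → assoc (lift K ℓ) ((lift K x , y) ∷ T′)) (sym (lift-< d<J))) (assoc-∷-lift K J x (suc d) ℓ (tunnels N (A ++ B) u (suc d) st) T′ (off ℓ))
    where
    T′ = tunnels (suc N) (A ++ true ∷ false ∷ B) u (suc d) (map (lift K) st)
    d<J : suc d < J
    d<J = subst (suc d <_) (sym eqJ) (s≤s (subst (d <_) (sym (+-suc d (downs A))) (s≤s (m≤m+n d (downs A)))))

  tunnel-labels : ∀ B {u d st ℓ c} → (ℓ , c) ∈ tunnels N B u d st → d < c
  tunnel-labels (true ∷ B)  {d = d}       t∈         = tunnel-labels B t∈
  tunnel-labels (false ∷ B) {st = []}     t∈         = <⇒≤ (tunnel-labels B t∈)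
  tunnel-labels (false ∷ B) {st = _ ∷ _} (here refl) = ≤-refl
  tunnel-labels (false ∷ B) {st = _ ∷ _} (there t∈)  = <⇒≤ (tunnel-labels B t∈)

  -- A tunnel closed within `A` was opened there or was on the stack already, and labels decrease
  -- from left to right.
  closed-early : ∀ A B {u d st ℓ c} → u + ups A ≤ N → All (N ∸ (u + ups A) <_) st →
    (ℓ , c) ∈ tunnels N (A ++ B) u d st → c ≤ d + downs A → N ∸ (u + ups A) < ℓ
  closed-early [] B {d = d} _ _ t∈ c≤ = contradiction (subst (_ ≤_) (+-identityʳ d) c≤) (<⇒≱ (tunnel-labels B t∈))
  closed-early (true ∷ A) B {u} u≤ st> t∈ c≤ rewrite +-suc u (ups A) =
    closed-early A B u≤ (∸-monoʳ-< (s≤s (m≤m+n u (ups A))) u≤ ∷ st>) t∈ c≤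
  closed-early (false ∷ A) B {d = d} {st = []} {c = c} u≤ st> t∈ c≤ = closed-early A B u≤ st> t∈ (subst (c ≤_) (+-suc d (downs A)) c≤)
  closed-early (false ∷ A) B {st = _ ∷ _} u≤ (p ∷ _) (here refl) c≤ = p
  closed-early (false ∷ A) B {d = d} {st = _ ∷ _} {c = c} u≤ (_ ∷ st>) (there t∈) c≤ =
    closed-early A B u≤ st> t∈ (subst (c ≤_) (+-suc d (downs A)) c≤)

  -- Later up-steps have smaller labels, so labels grow towards the bottom of the stack. The
  -- inequalities are weak because `N ∸ u` stays at 0 once `u` reaches `N`.
  StackSorted : ℕ → List ℕ → Set
  StackSorted u st = All (N ∸ u ≤_) st × AllPairs _≤_ st

  stack-push : ∀ {u st} → StackSorted u st → StackSorted (suc u) ((N ∸ u) ∷ st)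
  stack-push {u} (lo , srt) = (step ∷ All.map (≤-trans step) lo) , lo ∷ srt
    where
    step = ∸-monoʳ-≤ N (n≤1+n u)

  stack-pop : ∀ {u x st} → StackSorted u (x ∷ st) → StackSorted u st
  stack-pop (_ ∷ lo , _ ∷ srt) = lo , srt

  -- A larger label still to be closed lies below `q` in the stack, so `q` is popped first.
  stacked-closes-first : ∀ B {u d st q ℓ c} → StackSorted u st → q ∈ st →
    (ℓ , c) ∈ tunnels N B u d st → q < ℓ → assoc q (tunnels N B u d st) < c
  stacked-closes-first (true ∷ B) {u} ss q∈ t∈ q<ℓ = stacked-closes-first B (stack-push {u} ss) (there q∈) t∈ q<ℓ
  stacked-closes-first (false ∷ B) {st = x ∷ st} (_ , h ∷ _) (here refl) (here refl) q<ℓ = contradiction q<ℓ (<-irrefl refl)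
  stacked-closes-first (false ∷ B) {st = x ∷ st} (_ , h ∷ _) (there q∈) (here refl) q<ℓ = contradiction (All.lookup h q∈) (<⇒≱ q<ℓ)
  stacked-closes-first (false ∷ B) {u} {d} {x ∷ st} {q} ss q∈ (there t∈) q<ℓ with x ≟ q | q∈
  ... | yes refl | _         rewrite ≡ᵇ-refl x = tunnel-labels B t∈
  ... | no ne    | here eq   = contradiction (sym eq) ne
  ... | no ne    | there q∈′ rewrite ≡ᵇ-false ne = stacked-closes-first B (stack-pop {u} ss) q∈′ t∈ q<ℓ

  -- Tunnels do not cross.
  opened-closes-first : ∀ A B {u d st q ℓ c} → StackSorted u st →
    q ∈ st ⊎ (∃ λ w → u ≤ w × w < u + ups A × q ≡ N ∸ w) →
    (ℓ , c) ∈ tunnels N (A ++ B) u d st → d + downs A < c → q < ℓ → assoc q (tunnels N (A ++ B) u d st) < c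
  opened-closes-first [] B ss (inj₁ q∈) t∈ _ q<ℓ = stacked-closes-first B ss q∈ t∈ q<ℓ
  opened-closes-first [] B {u} ss (inj₂ (w , u≤w , w< , _)) = contradiction u≤w (<⇒≱ (subst (w <_) (+-identityʳ u) w<))
  opened-closes-first (true ∷ A) B {u} ss (inj₁ q∈) t∈ c> q<ℓ = opened-closes-first A B (stack-push {u} ss) (inj₁ (there q∈)) t∈ c> q<ℓ
  opened-closes-first (true ∷ A) B {u} ss (inj₂ (w , u≤w , w< , eq)) t∈ c> q<ℓ with m≤n⇒m<n∨m≡n u≤w
  ... | inj₁ u<w  = opened-closes-first A B (stack-push {u} ss) (inj₂ (w , u<w , subst (w <_) (+-suc u (ups A)) w< , eq)) t∈ c> q<ℓ
  ... | inj₂ refl = opened-closes-first A B (stack-push {u} ss) (inj₁ (here eq)) t∈ c> q<ℓ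
  opened-closes-first (false ∷ A) B {d = d} {st = []} {c = c} ss q∈ t∈ c> q<ℓ =
    opened-closes-first A B ss q∈ t∈ (subst (_< c) (+-suc d (downs A)) c>) q<ℓ
  opened-closes-first (false ∷ A) B {d = d} {st = x ∷ st} ss q∈ (here refl) c> q<ℓ =
    contradiction c> (≤⇒≯ (subst (suc d ≤_) (sym (+-suc d (downs A))) (s≤s (m≤m+n d (downs A)))))
  opened-closes-first (false ∷ A) B {u} {d} {x ∷ st} {q} {c = c} ss q∈ (there t∈) c> q<ℓ with x ≟ q | q∈
  ... | yes refl | _                rewrite ≡ᵇ-refl x = ≤-<-trans (subst (suc d ≤_) (sym (+-suc d (downs A))) (s≤s (m≤m+n d (downs A)))) c>
  ... | no ne    | inj₁ (here eq)   = contradiction (sym eq) ne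
  ... | no ne    | inj₁ (there q∈′) rewrite ≡ᵇ-false ne =
    opened-closes-first A B (stack-pop {u} ss) (inj₁ q∈′) t∈ (subst (_< c) (+-suc d (downs A)) c>) q<ℓ
  ... | no ne    | inj₂ q∈′         rewrite ≡ᵇ-false ne =
    opened-closes-first A B (stack-pop {u} ss) (inj₂ q∈′) t∈ (subst (_< c) (+-suc d (downs A)) c>) q<ℓ

-- The default value 0 of `assoc` marks an unmatched label. Positivity of the entries of a
-- permutation thus shows that each label belongs to an actual tunnel.
assoc-∈ : ∀ ℓ T → 1 ≤ assoc ℓ T → (ℓ , assoc ℓ T) ∈ T
assoc-∈ ℓ ((x , y) ∷ T) pos with x ≟ ℓ
... | yes refl rewrite ≡ᵇ-refl x    = here refl
... | no ne    rewrite ≡ᵇ-false ne = there (assoc-∈ ℓ T pos)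

Φinv-⟨⟩ : ∀ {n i} D → i < n → Φinv n D ⟨ suc i ⟩ ≡ assoc (suc i) (tunnels n D 0 0 [])
Φinv-⟨⟩ {n} D i<n = trans (cong (_⟨ suc _ ⟩) (map-applyUpTo suc (λ ℓ → assoc ℓ (tunnels n D 0 0 [])) n)) (⟨⟩-applyUpTo _ i<n)

Φinv-insertPeak : ∀ {N p} D → p ≤ N → p ≤ length D →
  Φinv (suc N) (insertPeak p D) ≡ ins (Φinv N D) (suc N ∸ ups (take p D)) (suc (downs (take p D)))
Φinv-insertPeak {N} {p} D p≤N p≤D = begin
  Φinv (suc N) (insertPeak p D)                        ≡⟨ map-applyUpTo suc (λ ℓ → assoc ℓ T′) (suc N) ⟩
  applyUpTo (λ i → assoc (suc i) T′) (suc N)           ≡⟨ applyUpTo-insert _ (λ i → lift J (assoc (suc i) T)) J (m∸n≤m N x) lo mid hi ⟩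
  insertAt (applyUpTo (λ i → lift J (assoc (suc i) T)) N) ≡⟨ cong insertAt (sym (map-applyUpTo (λ i → assoc (suc i) T) (lift J) N)) ⟩
  insertAt (map (lift J) (applyUpTo (λ i → assoc (suc i) T) N)) ≡⟨ cong (insertAt ∘ map (lift J)) (sym (map-applyUpTo suc (λ ℓ → assoc ℓ T) N)) ⟩
  insertAt (shiftFrom J (Φinv N D))                    ≡⟨ cong (λ k → take k (shiftFrom J (Φinv N D)) ++ J ∷ drop k (shiftFrom J (Φinv N D))) (sym (cong pred K≡)) ⟩
  ins (Φinv N D) K J                                   ∎
  where
  open ≡-Reasoning
  x = ups (take p D)
  K = suc N ∸ x
  J = suc (downs (take p D))
  T = tunnels N D 0 0 []
  T′ = tunnels (suc N) (insertPeak p D) 0 0 []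
  insertAt : List ℕ → List ℕ
  insertAt xs = take (N ∸ x) xs ++ J ∷ drop (N ∸ x) xs
  x≤N : x ≤ N
  x≤N = ≤-trans (m≤m+n x (downs (take p D))) (≤-trans (≤-reflexive (ups+downs-take D p≤D)) p≤N)
  K≡ : K ≡ suc (N ∸ x)
  K≡ = +-∸-assoc 1 x≤N
  spec : assoc K T′ ≡ J × (∀ ℓ → assoc (lift K ℓ) T′ ≡ lift J (assoc ℓ T))
  spec = subst (λ E → assoc K T′ ≡ J × (∀ ℓ → assoc (lift K ℓ) T′ ≡ lift J (assoc ℓ (tunnels N E 0 0 []))))
    (take++drop≡id p D) (tunnels-insertPeak N (take p D) (drop p D) x≤N refl refl)
  lo : ∀ i → i < N ∸ x → assoc (suc i) T′ ≡ lift J (assoc (suc i) T)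
  lo i i< = subst (λ ℓ → assoc ℓ T′ ≡ lift J (assoc (suc i) T)) (lift-< (subst (suc i <_) (sym K≡) (s≤s i<))) (proj₂ spec (suc i))
  mid : assoc (suc (N ∸ x)) T′ ≡ J
  mid = subst (λ ℓ → assoc ℓ T′ ≡ J) K≡ (proj₁ spec)
  hi : ∀ i → N ∸ x ≤ i → i < N → assoc (suc (suc i)) T′ ≡ lift J (assoc (suc i) T)
  hi i i≥ _ = subst (λ ℓ → assoc ℓ T′ ≡ lift J (assoc (suc i) T)) (lift-≥ (subst (_≤ suc i) (sym K≡) (s≤s i≥))) (proj₂ spec (suc i))

insert-⟨⟩-< : ∀ {x} xs {k i} → i < k → k ≤ length xs → (take k xs ++ x ∷ drop k xs) ⟨ suc i ⟩ ≡ xs ⟨ suc i ⟩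
insert-⟨⟩-< (y ∷ xs) {suc k} {zero}  _       _       = refl
insert-⟨⟩-< (y ∷ xs) {suc k} {suc i} (s≤s p) (s≤s q) = insert-⟨⟩-< xs p q

insert-⟨⟩-≡ : ∀ {x} xs {k} → k ≤ length xs → (take k xs ++ x ∷ drop k xs) ⟨ suc k ⟩ ≡ x
insert-⟨⟩-≡ xs       {zero}  _       = refl
insert-⟨⟩-≡ (y ∷ xs) {suc k} (s≤s p) = insert-⟨⟩-≡ xs p

insert-⟨⟩-> : ∀ {x} xs {k i} → k ≤ i → (take k xs ++ x ∷ drop k xs) ⟨ suc (suc i) ⟩ ≡ xs ⟨ suc i ⟩
insert-⟨⟩-> xs       {zero}          _       = refl
insert-⟨⟩-> []       {suc k}         _       = refl
insert-⟨⟩-> (y ∷ xs) {suc k} {suc i} (s≤s p) = insert-⟨⟩-> xs p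

module _ {β : List ℕ} {a k : ℕ} (k≤ : k ≤ length β) where

  private
    k≤′ : k ≤ length (shiftFrom a β)
    k≤′ = ≤-trans k≤ (≤-reflexive (sym (length-map _ β)))

  ins-⟨⟩-< : ∀ {i} → i < k → ins β (suc k) a ⟨ suc i ⟩ ≡ lift a (β ⟨ suc i ⟩)
  ins-⟨⟩-< i<k = trans (insert-⟨⟩-< (shiftFrom a β) i<k k≤′) (⟨⟩-map (lift a) β (≤-trans i<k k≤))

  ins-⟨⟩-≡ : ins β (suc k) a ⟨ suc k ⟩ ≡ a
  ins-⟨⟩-≡ = insert-⟨⟩-≡ (shiftFrom a β) k≤′

  ins-⟨⟩-> : ∀ {i} → k ≤ i → i < length β → ins β (suc k) a ⟨ suc (suc i) ⟩ ≡ lift a (β ⟨ suc i ⟩)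
  ins-⟨⟩-> k≤i i< = trans (insert-⟨⟩-> (shiftFrom a β) k≤i) (⟨⟩-map (lift a) β i<)

-- The recursion for Θ

length-accept : ∀ {y} x ys → y < x → length (filter (_<? x) (y ∷ ys)) ≡ suc (length (filter (_<? x) ys))
length-accept x ys y<x = cong length (filter-accept (_<? x) y<x)

length-reject : ∀ {y} x ys → ¬ (y < x) → length (filter (_<? x) (y ∷ ys)) ≡ length (filter (_<? x) ys)
length-reject x ys y≮x = cong length (filter-reject (_<? x) y≮x)

count-below-∉ : ∀ {x} xs → x ∉ xs → length (filter (_<? suc x) xs) ≡ length (filter (_<? x) xs)
count-below-∉ []       _ = refl
count-below-∉ {x} (y ∷ ys) x∉ with y <? x
... | yes y<x = trans (length-accept (suc x) ys (m<n⇒m<1+n y<x))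
  (trans (cong suc (count-below-∉ ys (x∉ ∘ there))) (sym (length-accept x ys y<x)))
... | no y≮x = trans (length-reject (suc x) ys (λ y≤x → y≮x (≤∧≢⇒< (≤-pred y≤x) (λ eq → x∉ (here (sym eq))))))
  (trans (count-below-∉ ys (x∉ ∘ there)) (sym (length-reject x ys y≮x)))

count-below-∈ : ∀ {x xs} → Unique xs → x ∈ xs → length (filter (_<? suc x) xs) ≡ suc (length (filter (_<? x) xs))
count-below-∈ {x} {y ∷ ys} (h ∷ u) (here refl) = trans (length-accept (suc x) ys (n<1+n x))
  (cong suc (trans (count-below-∉ ys (λ x∈ → All.lookup h x∈ refl)) (sym (length-reject x ys (<-irrefl refl)))))
count-below-∈ {x} {y ∷ ys} (h ∷ u) (there x∈) with y <? x
... | yes y<x = trans (length-accept (suc x) ys (m<n⇒m<1+n y<x))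
  (cong suc (trans (count-below-∈ u x∈) (sym (length-accept x ys y<x))))
... | no y≮x = trans (length-reject (suc x) ys (λ y≤x → y≮x (≤∧≢⇒< (≤-pred y≤x) (All.lookup h x∈))))
  (trans (count-below-∈ u x∈) (cong suc (sym (length-reject x ys y≮x))))

count-below-[1…] : ∀ {n} c → c ≤ n → length (filter (_<? suc c) [1… n ]) ≡ c
count-below-[1…] {n} zero _ = cong length (filter-none (_<? 1) {[1… n ]} (All.tabulate λ c∈ → ≤⇒≯ (proj₁ ([1…]-bounds c∈))))
count-below-[1…] {n} (suc c) c<n = trans (count-below-∈ ([1…]-unique n) (∈-[1…] (s≤s z≤n) c<n))
  (cong suc (count-below-[1…] c (<⇒≤ c<n)))

count-below-lift : ∀ b x xs → length (filter (_<? lift b x) (map (lift b) xs)) ≡ length (filter (_<? x) xs)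
count-below-lift b x []       = refl
count-below-lift b x (y ∷ ys) with y <? x
... | yes y<x = trans (length-accept (lift b x) (map (lift b) ys) (lift-mono b y<x))
  (trans (cong suc (count-below-lift b x ys)) (sym (length-accept x ys y<x)))
... | no y≮x  = trans (length-reject (lift b x) (map (lift b) ys) (y≮x ∘ lift-mono⁻ b))
  (trans (count-below-lift b x ys) (sym (length-reject x ys y≮x)))

red-lift : ∀ {n π} b → IsPerm n π → red (map (lift b) π) ≡ π
red-lift {n} {π} b perm = trans (sym (map-∘ π)) (map-id-local (All.tabulate rank))
  where
  rank : ∀ {x} → x ∈ π → suc (length (filter (_<? lift b x) (map (lift b) π))) ≡ x
  rank {x} x∈ with [1…]-bounds (∈-resp-↭ perm x∈)
  rank {suc c} x∈ | _ , c<n = cong suc (trans (count-below-lift b (suc c) π)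
    (trans (↭-length (filter-↭ (_<? suc c) perm)) (count-below-[1…] c (<⇒≤ c<n))))

take-applyUpTo-++ : ∀ {A : Set} (f : ℕ → A) {k n} ys → k ≤ n → take k (applyUpTo f n ++ ys) ≡ applyUpTo f k
take-applyUpTo-++ f {zero}          ys _       = refl
take-applyUpTo-++ f {suc k} {suc n} ys (s≤s p) = cong (f 0 ∷_) (take-applyUpTo-++ (f ∘ suc) ys p)

downs-++ : ∀ D E → downs (D ++ E) ≡ downs D + downs E
downs-++ []          E = refl
downs-++ (true ∷ D)  E = downs-++ D E
downs-++ (false ∷ D) E = cong suc (downs-++ D E)

length-Ψ : ∀ σ → length σ ≤ length (Ψ σ)
length-Ψ σ rewrite Ψ-words σ | length-++ (leftWord (finalState σ) (length σ)) {rightWord (finalState σ) (length σ)}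
  | length-applyUpTo (λ i → elemᵇ (suc i) (row₁ (finalState σ))) (length σ) = m≤m+n _ _

module _ {N π} (bij : IsBijection N π) (av : No321 N π) where
  open IsBijection bij

  private s = finalState π

  downs-leftWord : ∀ k → k ≤ N → downs (leftWord s k) ≡ length (filter (_<? suc k) (row₂ s))
  downs-leftWord zero _ = sym (cong length (filter-none (_<? 1) {row₂ s} (All.tabulate λ c∈ → ≤⇒≯ (positive₂ c∈))))
    where
    positive₂ : ∀ {c} → c ∈ row₂ s → 1 ≤ c
    positive₂ c∈ with ∈-⟨⟩ (∈-resp-↭ (final-entries bij av) (∈-++⁺ʳ (row₁ s) c∈))
    ... | p , p< , refl = positive (subst (p <_) len p<)
  downs-leftWord (suc k) k<N = begin
    downs (leftWord s (suc k))                                    ≡⟨ cong downs (sym (applyUpTo-∷ʳ _ k)) ⟩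
    downs (leftWord s k ∷ʳ elemᵇ (suc k) (row₁ s))                ≡⟨ downs-++ (leftWord s k) _ ⟩
    downs (leftWord s k) + downs [ elemᵇ (suc k) (row₁ s) ]       ≡⟨ cong (_+ downs [ elemᵇ (suc k) (row₁ s) ]) (downs-leftWord k (<⇒≤ k<N)) ⟩
    length (filter (_<? suc k) (row₂ s)) + downs [ elemᵇ (suc k) (row₁ s) ] ≡⟨ last-letter ⟩
    length (filter (_<? suc (suc k)) (row₂ s))                    ∎
    where
    open ≡-Reasoning
    unique₂ : Unique (row₂ s)
    unique₂ = Unique-++ʳ (row₁ s) (Unique-↭ (↭-sym (final-entries bij av)) unique)
      where
      Unique-++ʳ : ∀ xs {ys : List ℕ} → Unique (xs ++ ys) → Unique ys
      Unique-++ʳ []       u       = u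
      Unique-++ʳ (x ∷ xs) (_ ∷ u) = Unique-++ʳ xs u
    last-letter : length (filter (_<? suc k) (row₂ s)) + downs [ elemᵇ (suc k) (row₁ s) ] ≡ length (filter (_<? suc (suc k)) (row₂ s))
    last-letter with final-cover bij av (s≤s (z≤n {k})) k<N
    ... | inj₁ k∈₁ rewrite ∈⇒elemᵇ k∈₁ = trans (+-identityʳ _) (sym (count-below-∉ (row₂ s) (final-disjoint bij av k∈₁)))
    ... | inj₂ k∈₂ rewrite ∉⇒elemᵇ (row₁ s) (λ k∈₁ → final-disjoint bij av k∈₁ k∈₂) = trans (+-comm _ 1) (sym (count-below-∈ unique₂ k∈₂))

  -- A d at place `c` of the left half says that `c` is in the second row, hence is a matched
  -- excedance value. Here the number `j - 1` of the theorem becomes a count of down-steps.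
  downs-Ψ : ∀ k → k ≤ N → downs (take k (Ψ π)) ≡ length (filter (_<? suc k) (matchedExcValues π))
  downs-Ψ k k≤N = begin
    downs (take k (Ψ π))                                       ≡⟨ cong (downs ∘ take k) (Ψ-words π) ⟩
    downs (take k (leftWord s (length π) ++ rightWord s (length π))) ≡⟨ cong downs (take-applyUpTo-++ _ _ (≤-trans k≤N (≤-reflexive (sym len)))) ⟩
    downs (leftWord s k)                                       ≡⟨ downs-leftWord k k≤N ⟩
    length (filter (_<? suc k) (row₂ s))                       ≡⟨ cong (λ ρ → length (filter (_<? suc k) (row₂ (finalState ρ)))) (sym (take-all N π (≤-reflexive len))) ⟩
    length (filter (_<? suc k) (row₂ (state π N)))             ≡⟨ cong (length ∘ filter (_<? suc k)) (matchedExcValues-row₂ bij av) ⟩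
    length (filter (_<? suc k) (matchedExcValues π))           ∎
    where open ≡-Reasoning

  Θ-insert : ∀ {k} → k ≤ N → TailSorted bij av (suc k) →
    IsBijection (suc N) (map (lift (suc k)) π ∷ʳ suc k) → No321 (suc N) (map (lift (suc k)) π ∷ʳ suc k) →
    Θ (map (lift (suc k)) π ∷ʳ suc k) ≡ ins (Θ π) (suc N ∸ ups (take k (Ψ π))) (suc (downs (take k (Ψ π))))
  Θ-insert {k} k≤N sorted bijσ avσ = begin
    Φinv (length σ) (Ψ σ)                  ≡⟨ cong₂ Φinv (IsBijection.len bijσ) (Ψ-insert bij av k≤N sorted bijσ avσ) ⟩
    Φinv (suc N) (insertPeak k (Ψ π))      ≡⟨ Φinv-insertPeak (Ψ π) k≤N k≤Ψ ⟩
    ins (Φinv N (Ψ π)) a b                 ≡⟨ cong (λ l → ins (Φinv l (Ψ π)) a b) (sym len) ⟩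
    ins (Θ π) a b                          ∎
    where
    open ≡-Reasoning
    σ = map (lift (suc k)) π ∷ʳ suc k
    a = suc N ∸ ups (take k (Ψ π))
    b = suc (downs (take k (Ψ π)))
    k≤Ψ : k ≤ length (Ψ π)
    k≤Ψ = ≤-trans k≤N (≤-trans (≤-reflexive (sym len)) (length-Ψ π))

-- Without its last value the permutation runs through `[1… suc N ]` except `suc k`, which is the
-- lift of `[1… N ]`; so the front pulls back along the lift. The index `k` is the number of letters
-- before the peak.
last-decomposition : ∀ {N σ} → IsPerm (suc N) σ → ∃₂ λ k π →
  k ≤ N × IsPerm N π × take N σ ≡ map (lift (suc k)) π × σ ≡ map (lift (suc k)) π ∷ʳ suc k × σ ⟨ suc N ⟩ ≡ suc k
last-decomposition {N} {σ} perm with σ ⟨ suc N ⟩ in eq | IsBijection.positive bij (n<1+n N) | IsBijection.bounded bij (n<1+n N)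
  where bij = IsPerm⇒bijection perm
... | suc k | _ | s≤s k≤N with ↭-map-inv (lift (suc k)) (drop-∷ v∷front)
  where
  snoc : σ ≡ take N σ ∷ʳ suc k
  snoc = trans (snoc-last σ (IsPerm-length perm)) (cong (take N σ ∷ʳ_) eq)
  v∷front : suc k ∷ map (lift (suc k)) [1… N ] ↭ suc k ∷ take N σ
  v∷front = ↭-trans (insert-[1…] (s≤s z≤n) (s≤s k≤N)) (↭-trans (↭-sym perm)
    (↭-trans (↭-reflexive snoc) (↭-sym (∷↭∷ʳ (suc k) (take N σ)))))
...   | π , front , π↭ = k , π , k≤N , ↭-sym π↭ , front , snoc′ , refl
  where
  snoc′ : σ ≡ map (lift (suc k)) π ∷ʳ suc k
  snoc′ = trans (snoc-last σ (IsPerm-length perm)) (cong₂ _∷ʳ_ front eq)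

No321-unappend : ∀ {N π v} → IsBijection N π → No321 (suc N) (map (lift v) π ∷ʳ v) → No321 N π
No321-unappend {v = v} bij avσ i<j j<k k<N kj ji = avσ i<j j<k (m<n⇒m<1+n k<N)
  (subst₂ _<_ (sym (append-⟨⟩ bij k<N)) (sym (append-⟨⟩ bij (<-trans j<k k<N))) (lift-mono v kj))
  (subst₂ _<_ (sym (append-⟨⟩ bij (<-trans j<k k<N))) (sym (append-⟨⟩ bij (<-trans i<j (<-trans j<k k<N)))) (lift-mono v ji))

Θ-recursion : ∀ {N σ} → IsPerm (suc N) σ → Avoids321 σ →
  let π = red (take N σ)
      j = suc (length (filter (_<? σ ⟨ suc N ⟩) (matchedExcValues π))) in
  Θ σ ≡ ins (Θ π) (suc N ∸ σ ⟨ suc N ⟩ + j) j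
Θ-recursion {N} {σ} perm av with last-decomposition perm
... | k , π , k≤N , permπ , front , snoc , last rewrite last | front | red-lift (suc k) permπ = begin
  Θ σ                                                    ≡⟨ cong Θ snoc ⟩
  Θ (map (lift (suc k)) π ∷ʳ suc k)                      ≡⟨ Θ-insert bij avπ k≤N (No321⇒TailSorted bij avπ (s≤s z≤n) avσ) bijσ avσ ⟩
  ins (Θ π) (suc N ∸ x) (suc y)                          ≡⟨ cong (λ K → ins (Θ π) K (suc y)) position ⟩
  ins (Θ π) (N ∸ k + suc y) (suc y)                      ≡⟨ cong (λ y → ins (Θ π) (N ∸ k + suc y) (suc y)) (downs-Ψ bij avπ k k≤N) ⟩
  ins (Θ π) (N ∸ k + suc c) (suc c)                      ∎
  where
  open ≡-Reasoning
  x = ups (take k (Ψ π))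
  y = downs (take k (Ψ π))
  c = length (filter (_<? suc k) (matchedExcValues π))
  bij = IsPerm⇒bijection permπ
  bijσ = IsPerm⇒bijection (subst (IsPerm (suc N)) snoc perm)
  avσ : No321 (suc N) (map (lift (suc k)) π ∷ʳ suc k)
  avσ = subst (No321 (suc N)) snoc (Avoids321⇒No321 {σ = σ} (IsPerm-length perm) av)
  avπ = No321-unappend bij avσ
  x+y : x + y ≡ k
  x+y = ups+downs-take (Ψ π) (≤-trans k≤N (≤-trans (≤-reflexive (sym (IsPerm-length permπ))) (length-Ψ π)))
  -- As `x + y = k` is one less than the last value, `N + 1 - x` is `n - σ(n) + j` with `j = y + 1`.
  position : suc N ∸ x ≡ N ∸ k + suc y
  position = trans (cong (_∸ x) sum) (m+n∸m≡n x _)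
    where
    sum : suc N ≡ x + (N ∸ k + suc y)
    sum = begin
      suc N                     ≡⟨ cong suc (sym (m∸n+n≡m k≤N)) ⟩
      suc (N ∸ k + k)           ≡⟨ sym (+-suc (N ∸ k) k) ⟩
      N ∸ k + suc k             ≡⟨ cong (λ m → N ∸ k + suc m) (trans (sym x+y) (+-comm x y)) ⟩
      N ∸ k + (suc y + x)       ≡⟨ sym (+-assoc (N ∸ k) (suc y) x) ⟩
      N ∸ k + suc y + x         ≡⟨ +-comm _ x ⟩
      x + (N ∸ k + suc y)       ∎

-- The recursion for the inverse

No132 : ℕ → List ℕ → Set
No132 n α = ∀ {i j k} → i < j → j < k → k < n → α ⟨ suc i ⟩ < α ⟨ suc k ⟩ → α ⟨ suc k ⟩ < α ⟨ suc j ⟩ → ⊥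

Avoids132⇒No132 : ∀ {n α} → length α ≡ n → Avoids132 α → No132 n α
Avoids132⇒No132 refl av i<j j<k k<n a b = av _ _ _ (s≤s z≤n) (s≤s i<j) (s≤s j<k) k<n (a , b)

find-peak : ∀ (f : ℕ → Bool) l n → suc l < n → f l ≡ true → f (suc l) ≡ false →
  ∃ λ E → applyUpTo f n ≡ insertPeak l E × l ≤ length E
find-peak f zero (suc (suc n)) _ up down =
  applyUpTo (f ∘ suc ∘ suc) n , cong₂ _∷_ up (cong (_∷ applyUpTo (f ∘ suc ∘ suc) n) down) , z≤n
find-peak f zero (suc zero) (s≤s ())
find-peak f (suc l) (suc n) (s≤s l<n) up down with find-peak (f ∘ suc) l n l<n up down
... | E , eq , l≤ = f 0 ∷ E , cong (f 0 ∷_) eq , s≤s l≤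

take-insertPeak : ∀ p D → p ≤ length D → take p (insertPeak p D) ≡ take p D
take-insertPeak zero    D       _       = refl
take-insertPeak (suc p) (x ∷ D) (s≤s l) = cong (x ∷_) (take-insertPeak p D l)

-- Write k = κ + 1 and α(k) = a + 1; then p is the prefix length at which the peak must be inserted.
module _ {N κ a p β D} (bij : IsBijection N β) (β≡ : β ≡ Φinv N D)
         (a≤κ : a ≤ κ) (κ≤N : κ ≤ N) (p+κ : p + κ ≡ N + a) (p≤D : p ≤ length D)
         (av : No132 (suc N) (ins β (suc κ) (suc a)))
         (excedances-first : ∀ {i} → i < κ → suc i < ins β (suc κ) (suc a) ⟨ suc i ⟩) where
  open IsBijection bij

  private
    α = ins β (suc κ) (suc a)
    T = tunnels N D 0 0 []
    x = ups (take p D)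
    y = downs (take p D)

    x+y : x + y ≡ p
    x+y = ups+downs-take D p≤D

    p≤N : p ≤ N
    p≤N = +-cancelʳ-≤ κ p N (≤-trans (≤-reflexive p+κ) (+-monoʳ-≤ N a≤κ))

    κ≤β : κ ≤ length β
    κ≤β = ≤-trans κ≤N (≤-reflexive (sym len))

    balance : x + κ + y ≡ N + a
    balance = trans (+-assoc x κ y) (trans (cong (x +_) (+-comm κ y)) (trans (sym (+-assoc x y κ)) (trans (cong (_+ κ) x+y) p+κ)))

    x≤N : x ≤ N
    x≤N = ≤-trans (≤-trans (m≤m+n x y) (≤-reflexive x+y)) p≤N

    α-< : ∀ {i} → i < κ → α ⟨ suc i ⟩ ≡ lift (suc a) (β ⟨ suc i ⟩)
    α-< = ins-⟨⟩-< {β} κ≤β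

    α-≡ : α ⟨ suc κ ⟩ ≡ suc a
    α-≡ = ins-⟨⟩-≡ {β} κ≤β

    α-> : ∀ {i} → κ ≤ i → i < N → α ⟨ suc (suc i) ⟩ ≡ lift (suc a) (β ⟨ suc i ⟩)
    α-> κ≤i i<N = ins-⟨⟩-> {β} κ≤β κ≤i (≤-trans i<N (≤-reflexive (sym len)))

    β-assoc : ∀ {i} → i < N → β ⟨ suc i ⟩ ≡ assoc (suc i) T
    β-assoc {i} i<N = trans (cong (_⟨ suc i ⟩) β≡) (Φinv-⟨⟩ D i<N)

    tunnel : ∀ {i} → i < N → (suc i , β ⟨ suc i ⟩) ∈ T
    tunnel {i} i<N = subst (λ c → (suc i , c) ∈ T) (sym (β-assoc i<N))
      (assoc-∈ (suc i) T (subst (1 ≤_) (β-assoc i<N) (positive i<N)))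

    early-label : ∀ {i} → i < N → β ⟨ suc i ⟩ ≤ y → N ∸ x < suc i
    early-label i<N ≤y = closed-early N (take p D) (drop p D) x≤N []
      (subst (λ E → _ ∈ tunnels N E 0 0 []) (sym (take++drop≡id p D)) (tunnel i<N)) ≤y

    -- With too many down-steps there are too few up-steps, so the next up-label `N - x` exceeds
    -- `κ`. Its tunnel closes after the prefix, with a value above `y`. The value `a + 1` of `β` is
    -- closed within the prefix and so has a still larger label. In `α`, the inserted `a + 1`
    -- followed by these two entries is a 132.
    not-too-many-downs : ¬ (a < y)
    not-too-many-downs a<y with surjective (s≤s (z≤n {a})) (≤-trans a<y (≤-trans (≤-trans (m≤n+m y x) (≤-reflexive x+y)) p≤N))
    ... | r , r<N , at with N ∸ x in gap | κ<gap
      where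
      x+κ<N : x + κ < N
      x+κ<N = +-cancelʳ-< y (x + κ) N (subst (_< N + y) (sym balance) (+-monoʳ-< N a<y))
      κ<gap : κ < N ∸ x
      κ<gap = m+n≤o⇒m≤o∸n (suc κ) (≤-trans (≤-reflexive (cong suc (+-comm κ x))) x+κ<N)
    ...   | suc q | s≤s κ≤q = av (s≤s κ≤q) (s≤s q<r) (s≤s r<N)
      (subst₂ _<_ (sym α-≡) (sym α-r) (n<1+n _))
      (subst₂ _<_ (sym α-r) (sym (trans (α-> κ≤q (<-trans q<r r<N)) (lift-≥ (<-trans a<y late)))) (s≤s (≤-<-trans a<y late)))
      where
      q<r : q < r
      q<r = ≤-pred (subst (_< suc r) gap (early-label r<N (≤-trans (≤-reflexive at) a<y)))
      late : y < β ⟨ suc q ⟩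
      late = ≰⇒> λ ≤y → <-irrefl gap (early-label (<-trans q<r r<N) ≤y)
      α-r : α ⟨ suc (suc r) ⟩ ≡ suc (suc a)
      α-r = trans (α-> (≤-trans κ≤q (<⇒≤ q<r)) r<N) (trans (cong (lift (suc a)) at) (lift-≥ ≤-refl))

    -- Position `κ` is an excedance of `α`; a value at most `a` would not be lifted and would stay
    -- at most `κ`.
    first-label-late : ∀ {q} → suc q ≡ κ → a < β ⟨ suc q ⟩
    first-label-late refl = ≰⇒> λ βq≤a → <⇒≱ (excedances-first ≤-refl)
      (≤-trans (≤-reflexive (trans (α-< ≤-refl) (lift-< (s≤s βq≤a)))) (≤-trans βq≤a a≤κ))

    -- The entry at position `κ` of `β` exceeds `a`, so the value `a` stands elsewhere. If it stands
    -- before `κ`, then `a`, the entry at `κ` and the inserted `a + 1` form a 132 in `α`. If it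
    -- stands after, its tunnel opens before the one labelled `κ` and ends beyond the prefix; as
    -- tunnels do not cross, it encloses that one, which forces the entry at `κ` below `a`.
    not-too-few-downs : ¬ (y < a)
    not-too-few-downs y<a with surjective (≤-<-trans z≤n y<a) (≤-trans a≤κ κ≤N)
    ... | r , r<N , at = contra _ refl
      where
      -- The up-step labelled `κ` is the one with exactly `N - κ` up-steps before it, so this places
      -- it in the prefix.
      opened : N ∸ κ < x
      opened = m<n+o⇒m∸n<o N κ {{>-nonZero (≤-<-trans z≤n x>0)}} (subst (N <_) (+-comm x κ) N<x+κ)
        where
        N<x+κ : N < x + κ
        N<x+κ = +-cancelʳ-< y N (x + κ) (subst (N + y <_) (sym balance) (+-monoʳ-< N y<a))
        x>0 : 0 < x
        x>0 = +-cancelʳ-< κ 0 x (≤-<-trans κ≤N N<x+κ)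
      contra : ∀ κ′ → κ ≢ κ′
      contra zero    refl = contradiction (<-≤-trans y<a a≤κ) λ ()
      contra (suc q) refl with <-cmp r q
      ... | tri≈ _ refl _ = contradiction (≤-reflexive at) (<⇒≱ (first-label-late refl))
      ... | tri< r<q _ _  = av r<q (n<1+n q) (s≤s κ≤N)
        (subst₂ _<_ (sym (trans (α-< (m<n⇒m<1+n r<q)) (trans (cong (lift (suc a)) at) (lift-< ≤-refl)))) (sym α-≡) ≤-refl)
        (subst₂ _<_ (sym α-≡) (sym (trans (α-< ≤-refl) (lift-≥ (first-label-late refl)))) (s≤s (first-label-late refl)))
      ... | tri> _ _ q<r  = <-asym (first-label-late refl) (subst (_< a) (trans (cong (λ E → assoc (suc q) (tunnels N E 0 0 [])) (take++drop≡id p D)) (sym (β-assoc κ≤N)))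
        (opened-closes-first N (take p D) (drop p D) ([] , []) (inj₂ (N ∸ κ , z≤n , opened , sym (m∸[m∸n]≡n κ≤N)))
          (subst₂ (λ c E → (suc r , c) ∈ tunnels N E 0 0 []) at (sym (take++drop≡id p D)) (tunnel r<N)) y<a (s≤s q<r)))

  peak-downs : downs (take p D) ≡ a
  peak-downs with <-cmp y a
  ... | tri< lt _ _ = ⊥-elim (not-too-few-downs lt)
  ... | tri≈ _ eq _ = eq
  ... | tri> _ _ gt = ⊥-elim (not-too-many-downs gt)

  peak-ups : ups (take p D) + κ ≡ N
  peak-ups = +-cancelʳ-≡ y (x + κ) N (trans balance (cong (N +_) (sym peak-downs)))

  -- A peak in the left half after p would give an earlier non-excedance.
  no-later-peak : ∀ {l E} → p ≤ l → suc l < N → l ≤ length E → D ≢ insertPeak l E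
  no-later-peak {l} {E} p≤l l<N l≤E refl = contra N refl
    where
    X = ups (take l E)
    Y = downs (take l E)
    X+Y : X + Y ≡ l
    X+Y = ups+downs-take E l≤E
    x≤X : x ≤ X
    x≤X = subst (x ≤_) (cong ups (take-insertPeak l E l≤E)) (ups-take-mono D p≤l)
    contra : ∀ N₀ → N ≢ N₀
    contra zero     refl = contradiction l<N λ ()
    contra (suc N′) refl = <⇒≱ (excedances-first i<κ) (≤-trans (≤-reflexive (trans (α-< i<κ) (cong (lift (suc a)) β-at)))
        (≤-trans (lift-≤ (suc a) (suc Y)) Y<i))
      where
      l≤N′ : l ≤ N′
      l≤N′ = ≤-pred (<⇒≤ l<N)
      X≤N′ : X ≤ N′
      X≤N′ = ≤-trans (m≤m+n X Y) (≤-trans (≤-reflexive X+Y) l≤N′)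
      -- Here `N` is `suc N′`, and the peak gives `β` the value `Y + 1` at position `i + 1 = N - X`.
      -- Since `x ≤ X`, this position is at most `N - x = κ`. Both letters of the peak lie among the
      -- first `N`, so `X + Y + 2 ≤ N`, and even after the lift the value is at most `i + 1`.
      i = N′ ∸ X
      i<κ : i < κ
      i<κ = subst (_≤ κ) (+-∸-assoc 1 X≤N′) (≤-trans (∸-monoʳ-≤ (suc N′) x≤X)
        (≤-reflexive (trans (cong (_∸ x) (sym peak-ups)) (m+n∸m≡n x κ))))
      Y<i : suc (suc Y) ≤ suc i
      Y<i = s≤s (m+n≤o⇒m≤o∸n (suc Y) (subst (_≤ N′) (cong suc (trans (sym X+Y) (+-comm X Y))) (≤-pred l<N)))
      β-at : β ⟨ suc i ⟩ ≡ suc Y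
      β-at = trans (cong (_⟨ suc i ⟩) (trans β≡ (trans (Φinv-insertPeak E l≤N′ l≤E)
          (cong (λ K → ins (Φinv N′ E) K (suc Y)) (+-∸-assoc 1 X≤N′)))))
        (ins-⟨⟩-≡ {Φinv N′ E} (≤-trans (m∸n≤m N′ X) (≤-reflexive (sym length-Φinv))))
        where
        length-Φinv : length (Φinv N′ E) ≡ N′
        length-Φinv = trans (length-map _ [1… N′ ]) (length-applyUpTo suc N′)

IsPerm-append : ∀ {N τ k} → IsPerm N τ → k ≤ N → IsPerm (suc N) (map (lift (suc k)) τ ∷ʳ suc k)
IsPerm-append {N} {τ} {k} perm k≤N = ↭-trans (↭-sym (∷↭∷ʳ (suc k) _))
  (↭-trans (prep (suc k) (map⁺ (lift (suc k)) perm)) (insert-[1…] (s≤s z≤n) (s≤s k≤N)))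

ins-append : ∀ {N τ} v → length τ ≡ N → ins τ (suc N) v ≡ map (lift v) τ ∷ʳ v
ins-append {τ = τ} v refl = cong₂ (λ xs ys → xs ++ v ∷ ys)
  (take-all (length τ) (shiftFrom v τ) (≤-reflexive (length-map _ τ)))
  (drop-all (length τ) (shiftFrom v τ) (≤-reflexive (length-map _ τ)))

module _ {N τ κ a p} (permτ : IsPerm N τ) (avτ : Avoids321 τ) (permβ : IsPerm N (Θ τ))
         (a≤κ : a ≤ κ) (κ≤N : κ ≤ N) (p+κ : p + κ ≡ N + a)
         (avα : No132 (suc N) (ins (Θ τ) (suc κ) (suc a)))
         (excedances-first : ∀ {i} → i < κ → suc i < ins (Θ τ) (suc κ) (suc a) ⟨ suc i ⟩) where

  private
    D = Ψ τ
    v = suc p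
    σ = map (lift v) τ ∷ʳ v
    len = IsPerm-length permτ
    bij = IsPerm⇒bijection permτ
    bijβ = IsPerm⇒bijection permβ
    av = Avoids321⇒No321 {σ = τ} len avτ

    p≤N : p ≤ N
    p≤N = +-cancelʳ-≤ κ p N (≤-trans (≤-reflexive p+κ) (+-monoʳ-≤ N a≤κ))

    p≤D : p ≤ length D
    p≤D = ≤-trans p≤N (≤-trans (≤-reflexive (sym len)) (length-Ψ τ))

    β≡ : Θ τ ≡ Φinv N D
    β≡ = cong (λ l → Φinv l D) len

  permutation : IsPerm (suc N) σ
  permutation = IsPerm-append permτ p≤N

  private
    r = row₁ (finalState τ)

    -- If `l` were in the first row and `suc l` not, the left half would read ud at these two
    -- places: a peak behind the prefix, which `no-later-peak` excludes.
    next : ∀ {l} → v ≤ l → l < N → l ∈ r → suc l ∈ r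
    next {suc l} (s≤s p≤l) l<N l∈ with elemᵇ (suc (suc l)) r in eq
    ... | true  = elemᵇ⇒∈ r eq
    ... | false with find-peak (λ i → elemᵇ (suc i) r) l N l<N (∈⇒elemᵇ l∈) eq
    ...   | E , word , l≤E = ⊥-elim (no-later-peak bijβ β≡ a≤κ κ≤N p+κ p≤D avα excedances-first p≤l l<N
      (≤-trans l≤E (≤-trans (m≤m+n (length E) _) (≤-reflexive (sym (length-++ E)))))
      (trans (Ψ-words τ) (trans (cong (λ n → leftWord (finalState τ) n ++ rightWord (finalState τ) (length τ)) len)
        (trans (cong (_++ rightWord (finalState τ) (length τ)) word) (sym (insertPeak-++ l E l≤E))))))

    tail-sorted : TailSorted bij av v
    tail-sorted {i} {suc j} v≤i i<j j≤N i∈ with m≤n⇒m<n∨m≡n (≤-pred i<j)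
    ... | inj₁ i<j′ = next (≤-trans v≤i (<⇒≤ i<j′)) j≤N (tail-sorted v≤i i<j′ (<⇒≤ j≤N) i∈)
    ... | inj₂ refl = next v≤i j≤N i∈

    avσ : No321 (suc N) σ
    avσ = TailSorted⇒No321 bij av tail-sorted

  avoids : Avoids321 σ
  avoids = No321⇒Avoids321 {σ = σ} (IsPerm-length permutation) avσ

  Θ-inverse : Θ σ ≡ ins (Θ τ) (suc κ) (suc a)
  Θ-inverse = trans (Θ-insert bij av p≤N tail-sorted (IsPerm⇒bijection permutation) avσ)
    (cong₂ (ins (Θ τ)) position (cong suc (peak-downs bijβ β≡ a≤κ κ≤N p+κ p≤D avα excedances-first)))
    where
    x = ups (take p D)
    x+κ : x + κ ≡ N
    x+κ = peak-ups bijβ β≡ a≤κ κ≤N p+κ p≤D avα excedances-first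
    position : suc N ∸ x ≡ suc κ
    position = trans (cong (_∸ x) (trans (cong suc (sym x+κ)) (sym (+-suc x κ)))) (m+n∸m≡n x (suc κ))

-- Size one, and assembly of both recursions.

Avoids321-[1] : Avoids321 [ 1 ]
Avoids321-[1] i (suc j) (suc (suc k)) _ (s≤s i≤j) (s≤s j<k) (s≤s ()) _
Avoids321-[1] i (suc j) (suc zero) _ _ (s≤s ()) _ _

theorem2p1 : (∀ (n : ℕ) (σ : List ℕ) → IsPerm n σ → Avoids321 σ → n ≡ 1 → Θ σ ≡ σ)
    × (∀ (n : ℕ) (σ : List ℕ) → IsPerm n σ → Avoids321 σ → 1 < n →
    (π : List ℕ) → π ≡ red (take (n ∸ 1) σ) →
    (j : ℕ) → j ∸ 1 ≡ length (filter (λ v → v Data.Nat.<? σ ⟨ n ⟩) (matchedExcValues π)) → 1 ≤ j →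
    Θ σ ≡ ins (Θ π) (n ∸ σ ⟨ n ⟩ + j) j)
    × (∀ (m : ℕ) (α : List ℕ) → IsPerm m α → Avoids132 α → m ≡ 1 →
    IsPerm m α × Avoids321 α × Θ α ≡ α)
    × (∀ (m : ℕ) (α : List ℕ) → IsPerm m α → Avoids132 α → 1 < m →
    (k : ℕ) → 1 ≤ k → k ≤ m → α ⟨ k ⟩ ≤ k → (∀ i → 1 ≤ i → i < k → i < α ⟨ i ⟩) →
    (β : List ℕ) → IsPerm (m ∸ 1) β → Avoids132 β → ins β k (α ⟨ k ⟩) ≡ α →
    (τ : List ℕ) → IsPerm (m ∸ 1) τ → Avoids321 τ → Θ τ ≡ β →
    IsPerm m (ins τ m (m + α ⟨ k ⟩ ∸ k))
    × Avoids321 (ins τ m (m + α ⟨ k ⟩ ∸ k))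
    × Θ (ins τ m (m + α ⟨ k ⟩ ∸ k)) ≡ α)
theorem2p1 = size-one , recursion , (λ m α perm _ m≡1 → size-one⁻¹ m α perm m≡1) , inverse
  where
  size-one : ∀ n σ → IsPerm n σ → Avoids321 σ → n ≡ 1 → Θ σ ≡ σ
  size-one _ _ perm _ refl rewrite ↭-singleton-inv perm = refl

  recursion : ∀ n σ → IsPerm n σ → Avoids321 σ → 1 < n →
    ∀ π → π ≡ red (take (n ∸ 1) σ) →
    ∀ j → j ∸ 1 ≡ length (filter (_<? σ ⟨ n ⟩) (matchedExcValues π)) → 1 ≤ j →
    Θ σ ≡ ins (Θ π) (n ∸ σ ⟨ n ⟩ + j) j
  recursion (suc N) σ perm av _ _ refl (suc _) refl _ = Θ-recursion perm av

  size-one⁻¹ : ∀ m α → IsPerm m α → m ≡ 1 → IsPerm m α × Avoids321 α × Θ α ≡ α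
  size-one⁻¹ _ _ perm refl rewrite ↭-singleton-inv perm = ↭-refl , Avoids321-[1] , refl

  inverse : ∀ m α → IsPerm m α → Avoids132 α → 1 < m →
    ∀ k → 1 ≤ k → k ≤ m → α ⟨ k ⟩ ≤ k → (∀ i → 1 ≤ i → i < k → i < α ⟨ i ⟩) →
    ∀ β → IsPerm (m ∸ 1) β → Avoids132 β → ins β k (α ⟨ k ⟩) ≡ α →
    ∀ τ → IsPerm (m ∸ 1) τ → Avoids321 τ → Θ τ ≡ β →
    IsPerm m (ins τ m (m + α ⟨ k ⟩ ∸ k)) × Avoids321 (ins τ m (m + α ⟨ k ⟩ ∸ k)) × Θ (ins τ m (m + α ⟨ k ⟩ ∸ k)) ≡ α
  inverse (suc N) α perm av _ (suc κ) _ (s≤s κ≤N) αk≤k exc _ permβ _ ins≡ τ permτ avτ refl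
    with α ⟨ suc κ ⟩ | IsBijection.positive (IsPerm⇒bijection perm) (s≤s κ≤N)
  ... | suc a | _ = subst (λ σ → IsPerm (suc N) σ × Avoids321 σ × Θ σ ≡ α) (sym appended)
    ( permutation permτ avτ permβ a≤κ κ≤N p+κ avα exc′
    , avoids permτ avτ permβ a≤κ κ≤N p+κ avα exc′
    , trans (Θ-inverse permτ avτ permβ a≤κ κ≤N p+κ avα exc′) ins≡ )
    where
    a≤κ : a ≤ κ
    a≤κ = ≤-pred αk≤k
    κ≤N+a : κ ≤ N + a
    κ≤N+a = ≤-trans κ≤N (m≤m+n N a)
    p+κ : N + a ∸ κ + κ ≡ N + a
    p+κ = m∸n+n≡m κ≤N+a
    value : suc N + suc a ∸ suc κ ≡ suc (N + a ∸ κ)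
    value = trans (cong (_∸ κ) (+-suc N a)) (+-∸-assoc 1 κ≤N+a)
    appended : ins τ (suc N) (suc N + suc a ∸ suc κ) ≡ map (lift (suc (N + a ∸ κ))) τ ∷ʳ suc (N + a ∸ κ)
    appended = trans (ins-append _ (IsPerm-length permτ)) (cong (λ v → map (lift v) τ ∷ʳ v) value)
    avα : No132 (suc N) (ins (Θ τ) (suc κ) (suc a))
    avα = subst (No132 (suc N)) (sym ins≡) (Avoids132⇒No132 {α = α} (IsPerm-length perm) av)
    exc′ : ∀ {i} → i < κ → suc i < ins (Θ τ) (suc κ) (suc a) ⟨ suc i ⟩
    exc′ {i} i<κ = subst (λ ρ → suc i < ρ ⟨ suc i ⟩) (sym ins≡) (exc (suc i) (s≤s z≤n) (s≤s i<κ))
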